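{- Let $\Delta\ge2$ be an integer and $\Lambda$ a real constant. Let $G=(V,E,w)$ be a weighted tree with $|V|=n\ge2$, weights $w:E\to\mathbb{R}_{>0}$, and maximum degree at most $\Delta$. Suppose that for every $S\subseteq V$ with $G[S]$ connected and $|S|\ge2$ there is an edge $e_S\in E(G[S])$ whose removal from the tree $G[S]$ produces components $A$ and $B$ (vertex sets) satisfying $$\max\{|A|-1,|B|-1\}\le\left(1-\frac1\Delta\right)(|S|-1)$$ and which also satisfies $$w_{e_S}\le\Lambda\,\frac{W(S)}{|S|-1}.$$ Then $$\frac{\operatorname{OPT}_{\mathrm{card}}(G,w)}{\operatorname{OPT}_{\mathrm{free}}(G,w)}\le\Lambda\left(1+\left\lfloor\log_{\Delta/(\Delta-1)}(n-1)\right\rfloor\right).$$ In particular, for a weighted tree $G$ of maximum degree at most $\Delta$, this bound holds if $$\frac{\max_{e\in E}w_e}{\min_{e\in E}w_e}\le\Lambda.$$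
   Context: $W(S)=\sum_{xy\in E(G[S])}w_{xy}$. $d_G$ is the shortest-path metric of $(V,E)$ with every edge of length $1$ (weights are not lengths). $\operatorname{OPT}_{\mathrm{free}}(G,w)$ is the minimum of $\sum_{xy\in E}w_{xy}u(x,y)$ over all ultrametrics $u$ on $V$ (metrics with $u(x,y)\le\max\{u(x,z),u(z,y)\}$) with $u\ge d_G$ on all pairs. A rooted binary hierarchy $H$ on $V$ is a rooted tree whose leaves are the vertices of $V$ and whose internal nodes have exactly two children; $C_H(x,y)$ is the set of leaves below the lowest common ancestor of $x,y$; $h_H(x,x)=0$ and $h_H(x,y)=|C_H(x,y)|-1$ for $x\ne y$. $\operatorname{OPT}_{\mathrm{card}}(G,w)$ is the minimum of $\sum_{xy\in E}w_{xy}h_H(x,y)$ over all rooted binary hierarchies $H$ on $V$ with $h_H\ge d_G$ on all pairs. -}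

module Defs where

open import Algebra.Bundles using (CommutativeRing; Semiring)
import Algebra.Definitions.RawSemiring as RawSemiringOps
open import Data.Bool.Base using (if_then_else_)
open import Data.Fin.Base as Fin using (Fin)
import Data.Fin.Properties as Fin
open import Data.Fin.Subset using (Subset; _∈_; ∣_∣; ⊤)
open import Data.Fin.Subset.Properties using (_∈?_)
open import Data.List.Base using (List; _∷_; _∷ʳ_; [_]; _++_; length; allFin)
import Data.List.Membership.DecPropositional as ListMembership
open import Data.List.Relation.Binary.Permutation.Propositional using (_↭_)
open import Data.List.Relation.Unary.Linked using (Linked)
open import Data.List.Relation.Unary.Unique.Propositional using (Unique)
open import Data.Nat.Base as ℕ using (ℕ; zero; suc; z≤n; s≤s)
import Data.Nat.Properties as ℕ
open import Data.Product.Base using (Σ-syntax; ∃-syntax; _×_; _,_; uncurry)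
open import Data.Sum.Base using (_⊎_; inj₁; inj₂)
open import Data.Tree.Binary using (Tree; leaf; node; foldr)
open import Data.Unit.Base using () renaming (⊤ to Unit)
import Data.Vec.Base as Vec
open import Function.Bundles using (_⇔_)
import Function.Metric.Structures as Metric
open import Level using (Level; 0ℓ) renaming (suc to lsuc; _⊔_ to _⊔ˡ_)
open import Relation.Binary.Construct.Closure.ReflexiveTransitive using (Star)
open import Relation.Binary.Core using (Rel)
open import Relation.Binary.Definitions
  using (Symmetric; Irreflexive; Decidable; Cotransitive)
open import Relation.Binary.Lattice.Definitions using (Supremum)
open import Relation.Binary.PropositionalEquality.Core using (_≡_)
open import Relation.Binary.Structures using (IsStrictPartialOrder)
open import Relation.Nullary.Decidable using (does; _×-dec_)
open import Relation.Nullary.Negation using (¬_)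

-- The real numbers, axiomatised as a Cauchy complete Archimedean ordered
-- field.  Classically these axioms determine ℝ up to isomorphism.  They
-- are phrased with a cotransitive strict order instead of a decidable one,
-- so that constructive constructions of ℝ satisfy them as well.
record Reals (c ℓ₁ ℓ₂ : Level) : Set (lsuc (c ⊔ˡ ℓ₁ ⊔ˡ ℓ₂)) where
  field
    commutativeRing : CommutativeRing c ℓ₁

  open CommutativeRing commutativeRing public
    using (Carrier; _≈_; _+_; _*_; -_; _-_; 0#; 1#; semiring)
  open Semiring semiring public using (rawSemiring)
  open RawSemiringOps rawSemiring public using (sum; _^_)

  infix 4 _<_ _≤_ _#_

  field
    _<_                  : Rel Carrier ℓ₂
    isStrictPartialOrder : IsStrictPartialOrder _≈_ _<_
    <-cotrans            : Cotransitive _<_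
    <-tight              : ∀ {x y} → ¬ x < y → ¬ y < x → x ≈ y
    0<1                  : 0# < 1#
    +-monoˡ-<            : ∀ z {x y} → x < y → x + z < y + z
    *-pos                : ∀ {x y} → 0# < x → 0# < y → 0# < x * y

  _≤_ : Rel Carrier ℓ₂
  x ≤ y = ¬ y < x

  _#_ : Rel Carrier ℓ₂
  x # y = x < y ⊎ y < x

  fromℕ : ℕ → Carrier
  fromℕ m = RawSemiringOps._×_ rawSemiring m 1#

  infixl 6 _⊔_

  field
    inv      : ∀ x → x # 0# → Carrier
    inverseʳ : ∀ x (x#0 : x # 0#) → x * inv x x#0 ≈ 1#

    _⊔_      : Carrier → Carrier → Carrier
    supremum : Supremum _≤_ _⊔_

    archimedean : ∀ x → ∃[ m ] x < fromℕ m

    complete : (s : ℕ → Carrier) →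
      (∀ ε → 0# < ε → ∃[ N ] (∀ i j → N ℕ.≤ i → N ℕ.≤ j → s i < s j + ε)) →
      ∃[ l ] (∀ ε → 0# < ε →
        ∃[ N ] (∀ i → N ℕ.≤ i → s i < l + ε × l < s i + ε))

  infix 7 _/_⟨_⟩

  _/_⟨_⟩ : Carrier → (y : Carrier) → y # 0# → Carrier
  x / y ⟨ y#0 ⟩ = x * inv y y#0

  fromℕ>0 : ∀ {m} → 1 ℕ.≤ m → 0# < fromℕ m
  fromℕ>0 {suc zero}    _ = <-respʳ-≈ (sym (+-identityʳ 1#)) 0<1
    where
    open IsStrictPartialOrder isStrictPartialOrder using (<-respʳ-≈)
    open CommutativeRing commutativeRing using (sym; +-identityʳ)
  fromℕ>0 {suc (suc m)} _ =
    trans (fromℕ>0 {suc m} (s≤s z≤n))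
          (<-respˡ-≈ (+-identityˡ _) (+-monoˡ-< (fromℕ (suc m)) 0<1))
    where
    open IsStrictPartialOrder isStrictPartialOrder using (trans; <-respˡ-≈)
    open CommutativeRing commutativeRing using (+-identityˡ)

  fromℕ#0 : ∀ {m} → 1 ℕ.≤ m → fromℕ m # 0#
  fromℕ#0 1≤m = inj₂ (fromℕ>0 1≤m)

  module _ {a p} {A : Set a} (P : A → Set p) (f : A → Carrier) where

    IsMinimum : Carrier → Set (a ⊔ˡ p ⊔ˡ ℓ₁ ⊔ˡ ℓ₂)
    IsMinimum m = (∃[ x ] (P x × f x ≈ m)) × (∀ x → P x → m ≤ f x)

    IsMaximum : Carrier → Set (a ⊔ˡ p ⊔ˡ ℓ₁ ⊔ˡ ℓ₂)
    IsMaximum m = (∃[ x ] (P x × f x ≈ m)) × (∀ x → P x → f x ≤ m)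

  -- k = ⌊log_b x⌋ (for b > 1 and x ≥ 1)
  IsFloorLog : (b x : Carrier) → ℕ → Set ℓ₂
  IsFloorLog b x k = b ^ k ≤ x × x < b ^ suc k

record Graph (n : ℕ) : Set₁ where
  field
    Adj    : Rel (Fin n) 0ℓ
    adj?   : Decidable Adj
    sym    : Symmetric Adj
    irrefl : Irreflexive _≡_ Adj

module _ {n} (G : Graph n) where
  open Graph G

  degree : Fin n → ℕ
  degree x = ∣ Vec.tabulate (λ y → does (adj? x y)) ∣

  MaxDegree≤ : ℕ → Set
  MaxDegree≤ Δ = ∀ x → degree x ℕ.≤ Δ

  Induced : Subset n → Rel (Fin n) 0ℓ
  Induced S x y = x ∈ S × y ∈ S × Adj x y

  ConnectedOn : Subset n → Set
  ConnectedOn S = ∀ {x y} → x ∈ S → y ∈ S → Star (Induced S) x y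

  Acyclic : Set
  Acyclic = ∀ x xs → 2 ℕ.≤ length xs → Unique (x ∷ xs) →
            ¬ Linked Adj (x ∷ (xs ∷ʳ x))

  IsTree : Set
  IsTree = ConnectedOn ⊤ × Acyclic

  -- G[S] with the edge {p , q} removed
  InducedMinus : Subset n → (p q : Fin n) → Rel (Fin n) 0ℓ
  InducedMinus S p q x y =
    Induced S x y × ¬ (x ≡ p × y ≡ q) × ¬ (x ≡ q × y ≡ p)

  data Walk : Fin n → Fin n → ℕ → Set where
    []  : ∀ {x} → Walk x x 0
    _∷_ : ∀ {x y z k} → Adj x y → Walk y z k → Walk x z (suc k)

  -- d_G(x , y) = k
  IsDistance : Fin n → Fin n → ℕ → Set
  IsDistance x y k = Walk x y k × (∀ l → Walk x y l → k ℕ.≤ l)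

IsComponentOf : ∀ {n} → Rel (Fin n) 0ℓ → Fin n → Subset n → Set
IsComponentOf R x A = ∀ y → y ∈ A ⇔ Star R x y

module _ {n : ℕ} where
  open ListMembership (Fin._≟_ {n}) using () renaming (_∈?_ to _∈ˡ?_)

  BinaryTree : Set
  BinaryTree = Tree Unit (Fin n)

  leaves : BinaryTree → List (Fin n)
  leaves = foldr (λ ls _ rs → ls ++ rs) [_]

  -- The subtree rooted at the lowest common ancestor of the leaves x and y
  lca : BinaryTree → Fin n → Fin n → BinaryTree
  lca (leaf v)     x y = leaf v
  lca (node l t r) x y =
    if does (x ∈ˡ? leaves l ×-dec y ∈ˡ? leaves l) then lca l x y else
    if does (x ∈ˡ? leaves r ×-dec y ∈ˡ? leaves r) then lca r x y else
    node l t r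

  height : BinaryTree → Fin n → Fin n → ℕ
  height H x y =
    if does (x Fin.≟ y) then 0 else length (leaves (lca H x y)) ℕ.∸ 1

  IsHierarchy : BinaryTree → Set
  IsHierarchy H = leaves H ↭ allFin n

module Weighted {c ℓ₁ ℓ₂} (ℝ : Reals c ℓ₁ ℓ₂) where
  open Reals ℝ

  -- The values of w at non-adjacent pairs are never used.
  record WeightedGraph (n : ℕ) : Set (lsuc 0ℓ ⊔ˡ c ⊔ˡ ℓ₁ ⊔ˡ ℓ₂) where
    field
      graph : Graph n
    open Graph graph public using (Adj; adj?)
    field
      w     : Fin n → Fin n → Carrier
      w-sym : ∀ {x y} → Adj x y → w x y ≈ w y x
      w-pos : ∀ {x y} → Adj x y → 0# < w x y

  module _ {n} (G : WeightedGraph n) where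
    open WeightedGraph G

    -- The sum of f over E(G[S]), each edge taken once as a pair x < y
    ∑E[_] : Subset n → (Fin n → Fin n → Carrier) → Carrier
    ∑E[ S ] f = sum λ x → sum λ y →
      if does (x Fin.<? y ×-dec x ∈? S ×-dec y ∈? S ×-dec adj? x y)
      then f x y else 0#

    W : Subset n → Carrier
    W S = ∑E[ S ] w

    cost : (Fin n → Fin n → Carrier) → Carrier
    cost u = ∑E[ ⊤ ] (λ x y → w x y * u x y)

    IsUltrametric : (Fin n → Fin n → Carrier) → Set (ℓ₁ ⊔ˡ ℓ₂ ⊔ˡ c)
    IsUltrametric u = Metric.IsGeneralMetric _≡_ _≈_ _≤_ 0# _⊔_ u

    FreeFeasible : (Fin n → Fin n → Carrier) → Set _
    FreeFeasible u =
      IsUltrametric u ×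
      (∀ x y k → IsDistance graph x y k → fromℕ k ≤ u x y)

    CardFeasible : BinaryTree {n} → Set
    CardFeasible H =
      IsHierarchy H ×
      (∀ x y k → IsDistance graph x y k → k ℕ.≤ height H x y)

    IsOPT-free : Carrier → Set _
    IsOPT-free = IsMinimum FreeFeasible cost

    IsOPT-card : Carrier → Set _
    IsOPT-card = IsMinimum CardFeasible (λ H → cost (λ x y → fromℕ (height H x y)))

    IsMaxWeight IsMinWeight : Carrier → Set (ℓ₁ ⊔ˡ ℓ₂)
    IsMaxWeight = IsMaximum {A = Fin n × Fin n} (uncurry Adj) (uncurry w)
    IsMinWeight = IsMinimum {A = Fin n × Fin n} (uncurry Adj) (uncurry w)

    minWeight#0 : ∀ {m} → IsMinWeight m → m # 0#
    minWeight#0 ((_ , adj , w≈m) , _) = inj₂ (<-respʳ-≈ w≈m (w-pos adj))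
      where open IsStrictPartialOrder isStrictPartialOrder using (<-respʳ-≈)

    WeightRatio≤ : Carrier → Set _
    WeightRatio≤ Λ =
      ∃[ M ] ∃[ m ] Σ[ isMin ∈ IsMinWeight m ]
        IsMaxWeight M × M / m ⟨ minWeight#0 isMin ⟩ ≤ Λ

    -- The edge pq of G[S] is a split as required of e_S; A and B are the
    -- sides of p and of q.
    IsBalancedSplit : (Δ : ℕ) → 2 ℕ.≤ Δ → Carrier → (S : Subset n) → 2 ℕ.≤ ∣ S ∣ →
                      (p q : Fin n) (A B : Subset n) → Set ℓ₂
    IsBalancedSplit Δ 2≤Δ Λ S 2≤∣S∣ p q A B =
      Induced graph S p q ×
      IsComponentOf (InducedMinus graph S p q) p A ×
      IsComponentOf (InducedMinus graph S p q) q B ×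
      fromℕ ((∣ A ∣ ℕ.∸ 1) ℕ.⊔ (∣ B ∣ ℕ.∸ 1))
        ≤ (1# - 1# / fromℕ Δ ⟨ fromℕ#0 (ℕ.<⇒≤ 2≤Δ) ⟩) * fromℕ (∣ S ∣ ℕ.∸ 1) ×
      w p q ≤ Λ * (W S / fromℕ (∣ S ∣ ℕ.∸ 1) ⟨ fromℕ#0 (ℕ.∸-monoˡ-≤ 1 2≤∣S∣) ⟩)

    HasBalancedSplits : (Δ : ℕ) → 2 ℕ.≤ Δ → Carrier → Set _
    HasBalancedSplits Δ 2≤Δ Λ =
      ∀ S → ConnectedOn graph S → (2≤∣S∣ : 2 ℕ.≤ ∣ S ∣) →
      ∃[ p ] ∃[ q ] ∃[ A ] ∃[ B ] IsBalancedSplit Δ 2≤Δ Λ S 2≤∣S∣ p q A B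

    RatioBound : (Δ : ℕ) → 2 ℕ.≤ Δ → Carrier → Set _
    RatioBound Δ 2≤Δ Λ =
      ∀ card free k → IsOPT-card card → IsOPT-free free →
      IsFloorLog (fromℕ Δ / fromℕ (Δ ℕ.∸ 1) ⟨ fromℕ#0 (ℕ.∸-monoˡ-≤ 1 2≤Δ) ⟩)
                 (fromℕ (n ℕ.∸ 1)) k →
      Σ[ free>0 ∈ 0# < free ]
        card / free ⟨ inj₂ free>0 ⟩ ≤ Λ * (1# + fromℕ k)

{-# OPTIONS --safe #-}
module Submission where

-- Write m(S) = |S| - 1 and b = Δ/(Δ-1).
--
-- Lower bound.  A feasible ultrametric is at least d_G = 1 on every edge, so
-- it costs at least W(V); hence OPT_free ≥ W(V) (lemma W⊤≤cost).
--
-- Upper bound.  Split V along e_V, split the two parts again, and so on down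
-- to single vertices.  The recursion tree is a hierarchy H.  Every cluster S
-- of H is connected, so a simple path inside S shows d_G ≤ m(S) on S, that
-- is, h_H ≥ d_G.  Each edge of G is removed from exactly one cluster S, where
-- it contributes w(e_S) m(S) ≤ Λ W(S).  A split shrinks m by the factor b, so
-- from m(S) < b^j at most j levels of splits follow; as the clusters of one
-- level are disjoint, the part of H below S costs at most Λ j W(S) (lemma
-- hierarchy).  With j = 1 + ⌊log_b (n-1)⌋ and S = V this bounds OPT_card by
-- Λ j W(V) ≤ Λ j OPT_free (lemma ratioBound).
--
-- Bounded weight ratio.  Every connected S with |S| ≥ 2 has an edge both of
-- whose sides A satisfy Δ m(A) ≤ (Δ-1) m(S).  To find it, keep a directed
-- edge (p,q) whose p-side is small enough.  If the q-side is still too big,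
-- then, as it consists of q and at most Δ-1 branches, some branch at a
-- neighbour c of q has at least m(S)/Δ vertices; so the q-side of (q,c) is
-- small enough, and (q,c) has a smaller c-side (lemma descend).  Moreover G[S]
-- has m(S) edges, so min w · m(S) ≤ W(S) (lemma minWeight*m≤W), and therefore
-- w(e) m(S) ≤ max w · m(S) ≤ Λ · min w · m(S) ≤ Λ W(S) for every edge e.
--
-- The order x ≤ y of the reals is the negation of y < x, hence stable under
-- double negation.  Splits, hierarchies and components are accordingly
-- constructed only up to double negation, where reachability in a graph may
-- be taken to be decidable.  Only 0 < OPT_free needs a direct argument.

open import Defs
open import Algebra.Bundles using (CommutativeRing)
import Algebra.Properties.Semiring.Mult as SemiringMult
import Algebra.Properties.Semiring.Sum as SemiringSum
import Algebra.Solver.Ring.NaturalCoefficients.Default as NaturalCoefficients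
open import Data.Bool.Base using (if_then_else_)
open import Data.Fin.Base as Fin using (Fin; zero; suc)
import Data.Fin.Properties as Fin
open import Data.Fin.Subset
  using (Subset; inside; outside; _∈_; _∉_; _⊆_; _∪_; _∩_; ⁅_⁆; ∣_∣; ⊤; Nonempty; Empty)
  renaming (_-_ to _∖_)
open import Data.Fin.Subset.Properties
open import Data.List.Base as List using (List; []; _∷_; _∷ʳ_; length)
import Data.List.Membership.DecPropositional as DecMembership
open import Data.List.Membership.Propositional using () renaming (_∈_ to _∈ˡ_; _∉_ to _∉ˡ_)
open import Data.List.Membership.Propositional.Properties using (∈-++⁺ˡ; ∈-++⁺ʳ; ∈-++⁻; ∈-allFin)
open import Data.List.Membership.Propositional.Properties.WithK using (unique∧set⇒bag)
import Data.List.Properties as List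
open import Data.List.Relation.Binary.BagAndSetEquality using (∼bag⇒↭)
open import Data.List.Relation.Unary.All as All using (All; []; _∷_)
open import Data.List.Relation.Unary.All.Properties using (¬Any⇒All¬)
open import Data.List.Relation.Unary.AllPairs using ([]; _∷_)
open import Data.List.Relation.Unary.Any using (here; there)
open import Data.List.Relation.Unary.Linked using (Linked; [-]; _∷_)
open import Data.List.Relation.Unary.Unique.Propositional using (Unique)
import Data.List.Relation.Unary.Unique.Propositional.Properties as Unique
open import Data.Nat.Base as ℕ using (ℕ; zero; suc; z≤n; s≤s)
import Data.Nat.Properties as ℕ
open import Data.Product.Base as Product using (∃-syntax; _×_; _,_; proj₁; proj₂)
open import Data.Sum.Base as Sum using (_⊎_; inj₁; inj₂; [_,_]′)
open import Data.Tree.Binary using (leaf; node)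
open import Data.Unit.Base using (tt)
open import Data.Vec.Base as Vec using ([]; _∷_)
import Data.Vec.Properties as Vec
open import Function.Base using (_∘_)
open import Function.Bundles using (mk⇔; Equivalence)
open import Level using () renaming (_⊔_ to _⊔ˡ_)
open import Relation.Binary.Construct.Closure.ReflexiveTransitive as Star using (Star; ε; _◅_; _◅◅_)
open import Relation.Binary.Core using (Rel)
open import Relation.Binary.Definitions using (tri<; tri≈; tri>)
import Relation.Binary.PropositionalEquality as ≡
open ≡ using (_≡_; _≢_)
open import Relation.Binary.Structures using (IsStrictPartialOrder)
open import Relation.Nullary.Decidable
  using (Dec; yes; no; does; ¬?; _×-dec_; dec-true; dec-false; ¬¬-excluded-middle)
open import Relation.Nullary.Negation using (¬_; contradiction; ¬¬-map; negated-stable)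

private variable n : ℕ

-- Double negation

¬¬-bind : ∀ {a b} {A : Set a} {B : Set b} → ¬ ¬ A → (A → ¬ ¬ B) → ¬ ¬ B
¬¬-bind ¬¬a f ¬b = ¬¬a λ a → f a ¬b

-- Double negation commutes with finite conjunctions.
¬¬-∀ : ∀ {p} {P : Fin n → Set p} → (∀ i → ¬ ¬ P i) → ¬ ¬ (∀ i → P i)
¬¬-∀ {zero}  _   ¬P = ¬P λ ()
¬¬-∀ {suc n} ¬¬P ¬P = ¬¬P zero λ p₀ → ¬¬-∀ (¬¬P ∘ suc) λ ps →
  ¬P λ { zero → p₀ ; (suc i) → ps i }

-- Cardinalities of finite sets

inclusion-exclusion : ∀ (p q : Subset n) → ∣ p ∪ q ∣ ℕ.+ ∣ p ∩ q ∣ ≡ ∣ p ∣ ℕ.+ ∣ q ∣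
inclusion-exclusion []            []            = ≡.refl
inclusion-exclusion (outside ∷ p) (outside ∷ q) = inclusion-exclusion p q
inclusion-exclusion (outside ∷ p) (inside  ∷ q) =
  ≡.trans (≡.cong suc (inclusion-exclusion p q)) (≡.sym (ℕ.+-suc ∣ p ∣ ∣ q ∣))
inclusion-exclusion (inside  ∷ p) (outside ∷ q) = ≡.cong suc (inclusion-exclusion p q)
inclusion-exclusion (inside  ∷ p) (inside  ∷ q) = ≡.cong suc
  (≡.trans (ℕ.+-suc ∣ p ∪ q ∣ ∣ p ∩ q ∣)
    (≡.trans (≡.cong suc (inclusion-exclusion p q)) (≡.sym (ℕ.+-suc ∣ p ∣ ∣ q ∣))))

∣p∪q∣≤∣p∣+∣q∣ : ∀ (p q : Subset n) → ∣ p ∪ q ∣ ℕ.≤ ∣ p ∣ ℕ.+ ∣ q ∣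
∣p∪q∣≤∣p∣+∣q∣ p q = ≡.subst (∣ p ∪ q ∣ ℕ.≤_) (inclusion-exclusion p q) (ℕ.m≤m+n _ _)

Empty⇒∣p∣≡0 : ∀ {p : Subset n} → Empty p → ∣ p ∣ ≡ 0
Empty⇒∣p∣≡0 {n} ¬∃ = ≡.trans (≡.cong ∣_∣ (Empty-unique ¬∃)) (∣⊥∣≡0 n)

∣disjoint∪∣ : ∀ {p q : Subset n} → (∀ {x} → x ∈ p → x ∉ q) → ∣ p ∪ q ∣ ≡ ∣ p ∣ ℕ.+ ∣ q ∣
∣disjoint∪∣ {p = p} {q} disj = ≡.trans (≡.sym (ℕ.+-identityʳ _))
  (≡.trans (≡.cong (∣ p ∪ q ∣ ℕ.+_) (≡.sym (Empty⇒∣p∣≡0 λ (x , x∈) →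
            let (x∈p , x∈q) = x∈p∩q⁻ p q x∈ in disj x∈p x∈q)))
         (inclusion-exclusion p q))

1≤∣p∣⇒Nonempty : ∀ {p : Subset n} → 1 ℕ.≤ ∣ p ∣ → Nonempty p
1≤∣p∣⇒Nonempty {p = p} 1≤∣p∣ with nonempty? p
... | yes ne = ne
... | no ¬ne = contradiction (≡.subst (1 ℕ.≤_) (Empty⇒∣p∣≡0 ¬ne) 1≤∣p∣) λ ()

x∈p⇒1≤∣p∣ : ∀ {p : Subset n} {x} → x ∈ p → 1 ℕ.≤ ∣ p ∣
x∈p⇒1≤∣p∣ x∈p = ℕ.≤-trans (s≤s z≤n) (x∈p⇒∣p-x∣<∣p∣ x∈p)

module _ {p} {P : Fin n → Set p} (P? : ∀ x → Dec (P x)) where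

  -- The subset of all x satisfying P.
  comprehension : Subset n
  comprehension = Vec.tabulate (does ∘ P?)

  comprehension⁺ : ∀ {x} → P x → x ∈ comprehension
  comprehension⁺ {x} px = Vec.lookup⇒[]= x _
    (≡.trans (Vec.lookup∘tabulate (does ∘ P?) x) (dec-true (P? x) px))

  comprehension⁻ : ∀ {x} → x ∈ comprehension → P x
  comprehension⁻ {x} x∈
    with P? x | ≡.trans (≡.sym (Vec.lookup∘tabulate (does ∘ P?) x)) (Vec.[]=⇒lookup x∈)
  ... | yes px | _ = px
  ... | no  _  | ()

∣p∣≤1+∣p-x∣ : ∀ (p : Subset n) x → ∣ p ∣ ℕ.≤ suc ∣ p ∖ x ∣
∣p∣≤1+∣p-x∣ p x = begin
  ∣ p ∣                    ≤⟨ p⊆q⇒∣p∣≤∣q∣ p⊆ ⟩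
  ∣ ⁅ x ⁆ ∪ (p ∖ x) ∣      ≤⟨ ∣p∪q∣≤∣p∣+∣q∣ ⁅ x ⁆ (p ∖ x) ⟩
  ∣ ⁅ x ⁆ ∣ ℕ.+ ∣ p ∖ x ∣  ≡⟨ ≡.cong (ℕ._+ ∣ p ∖ x ∣) (∣⁅x⁆∣≡1 x) ⟩
  suc ∣ p ∖ x ∣            ∎
  where
  open ℕ.≤-Reasoning
  p⊆ : p ⊆ ⁅ x ⁆ ∪ (p ∖ x)
  p⊆ {y} y∈p with y Fin.≟ x
  ... | yes ≡.refl = x∈p∪q⁺ (inj₁ (x∈⁅x⁆ x))
  ... | no  y≢x    = x∈p∪q⁺ (inj₂ (x∈p∧x≢y⇒x∈p-y y∈p y≢x))

∈-remove⇒≢ : ∀ {p : Subset n} {x y} → y ∈ p ∖ x → y ≢ x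
∈-remove⇒≢ {p = p} {x} y∈ ≡.refl = ℕ.<-irrefl ≡.refl
  (ℕ.<-≤-trans (x∈p⇒∣p-x∣<∣p∣ y∈) (∣p-x∣≤∣p-x-x∣))
  where
  ∣p-x∣≤∣p-x-x∣ : ∣ p ∖ x ∣ ℕ.≤ ∣ p ∖ x ∖ x ∣
  ∣p-x∣≤∣p-x-x∣ = ℕ.≤-reflexive (≡.cong ∣_∣ (≡.sym (p─q─q≡p─q p ⁅ x ⁆)))

two-elements : ∀ {p : Subset n} → 2 ℕ.≤ ∣ p ∣ → ∃[ x ] ∃[ y ] x ∈ p × y ∈ p × x ≢ y
two-elements {p = p} 2≤∣p∣ =
  let (x , x∈p) = 1≤∣p∣⇒Nonempty (ℕ.≤-trans (s≤s z≤n) 2≤∣p∣)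
      (y , y∈)  = 1≤∣p∣⇒Nonempty (ℕ.s≤s⁻¹ (ℕ.≤-trans 2≤∣p∣ (∣p∣≤1+∣p-x∣ p x)))
  in x , y , x∈p , p─q⊆p p ⁅ x ⁆ y∈ , λ x≡y → ∈-remove⇒≢ {p = p} y∈ (≡.sym x≡y)

distinct⇒2≤∣p∣ : ∀ {p : Subset n} {x y} → x ∈ p → y ∈ p → x ≢ y → 2 ℕ.≤ ∣ p ∣
distinct⇒2≤∣p∣ x∈p y∈p x≢y = ℕ.≤-trans (s≤s (x∈p⇒1≤∣p∣ (x∈p∧x≢y⇒x∈p-y x∈p x≢y))) (x∈p⇒∣p-x∣<∣p∣ y∈p)

Unique⇒length≤∣p∣ : ∀ {p : Subset n} {xs} → Unique xs → All (_∈ p) xs → length xs ℕ.≤ ∣ p ∣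
Unique⇒length≤∣p∣ []         []           = z≤n
Unique⇒length≤∣p∣ (x∉ ∷ uxs) (x∈p ∷ xs∈p) = ℕ.≤-trans
  (s≤s (Unique⇒length≤∣p∣ uxs
    (All.zipWith (λ (x≢y , y∈p) → x∈p∧x≢y⇒x∈p-y y∈p (x≢y ∘ ≡.sym)) (x∉ , xs∈p))))
  (x∈p⇒∣p-x∣<∣p∣ x∈p)

-- The union bound |T| ≤ Σ |F i| over i in N, with each summand at most K / c.
covered⇒*∣T∣≤ : ∀ c K k (F : Fin n → Subset n) (N T : Subset n) → ∣ N ∣ ℕ.≤ k →
  (∀ {i} → i ∈ N → c ℕ.* ∣ F i ∣ ℕ.≤ K) →
  (∀ {x} → x ∈ T → ∃[ i ] i ∈ N × x ∈ F i) →
  c ℕ.* ∣ T ∣ ℕ.≤ k ℕ.* K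
covered⇒*∣T∣≤ c K k F N T ∣N∣≤k bound cover with nonempty? N
... | no ¬ne = ≡.subst (ℕ._≤ k ℕ.* K) (≡.sym (≡.trans (≡.cong (c ℕ.*_)
      (Empty⇒∣p∣≡0 λ (x , x∈T) → let (i , i∈N , _) = cover x∈T in ¬ne (i , i∈N)))
      (ℕ.*-zeroʳ c))) z≤n
covered⇒*∣T∣≤ c K zero F N T ∣N∣≤0 bound cover | yes (i , i∈N) =
  contradiction (ℕ.≤-trans (x∈p⇒1≤∣p∣ i∈N) ∣N∣≤0) λ ()
covered⇒*∣T∣≤ {n} c K (suc k) F N T ∣N∣≤k bound cover | yes (i , i∈N) = begin
  c ℕ.* ∣ T ∣                       ≤⟨ ℕ.*-monoʳ-≤ c (p⊆q⇒∣p∣≤∣q∣ T⊆) ⟩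
  c ℕ.* ∣ F i ∪ T′ ∣                ≤⟨ ℕ.*-monoʳ-≤ c (∣p∪q∣≤∣p∣+∣q∣ (F i) T′) ⟩
  c ℕ.* (∣ F i ∣ ℕ.+ ∣ T′ ∣)        ≡⟨ ℕ.*-distribˡ-+ c ∣ F i ∣ ∣ T′ ∣ ⟩
  c ℕ.* ∣ F i ∣ ℕ.+ c ℕ.* ∣ T′ ∣    ≤⟨ ℕ.+-mono-≤ (bound i∈N)
                                        (covered⇒*∣T∣≤ c K k F (N ∖ i) T′ ∣N-i∣≤k (bound ∘ N-i⊆N) cover′) ⟩
  K ℕ.+ k ℕ.* K                     ∎
  where
  open ℕ.≤-Reasoning
  T′? = λ x → (x ∈? T) ×-dec ¬? (x ∈? F i)
  T′ = comprehension T′?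
  T⊆ : T ⊆ F i ∪ T′
  T⊆ {x} x∈T with x ∈? F i
  ... | yes x∈F = x∈p∪q⁺ (inj₁ x∈F)
  ... | no  x∉F = x∈p∪q⁺ (inj₂ (comprehension⁺ T′? (x∈T , x∉F)))
  N-i⊆N : N ∖ i ⊆ N
  N-i⊆N = p─q⊆p N ⁅ i ⁆
  ∣N-i∣≤k : ∣ N ∖ i ∣ ℕ.≤ k
  ∣N-i∣≤k = ℕ.s≤s⁻¹ (ℕ.≤-trans (x∈p⇒∣p-x∣<∣p∣ i∈N) ∣N∣≤k)
  cover′ : ∀ {x} → x ∈ T′ → ∃[ j ] j ∈ N ∖ i × x ∈ F j
  cover′ x∈T′ =
    let (x∈T , x∉Fi)     = comprehension⁻ T′? x∈T′
        (j , j∈N , x∈Fj) = cover x∈T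
    in j , x∈p∧x≢y⇒x∈p-y j∈N (λ j≡i → x∉Fi (≡.subst (λ l → _ ∈ F l) j≡i x∈Fj)) , x∈Fj

-- Simple paths

-- Path R x y xs: x followed by the list xs is an R-path ending at y.
data Path {ℓ} (R : Rel (Fin n) ℓ) : Fin n → Fin n → List (Fin n) → Set ℓ where
  []  : ∀ {x} → Path R x x []
  _∷_ : ∀ {x y z xs} → R x y → Path R y z xs → Path R x z (y ∷ xs)

module _ {ℓ} {R : Rel (Fin n) ℓ} where

  -- The part of a simple path after one of its vertices.
  path-suffix : ∀ {x y z xs} → Path R y z xs → Unique (y ∷ xs) → x ∈ˡ y ∷ xs →
                ∃[ ys ] Path R x z ys × Unique (x ∷ ys)
  path-suffix p       u       (here ≡.refl) = _ , p , u
  path-suffix (_ ∷ p) (_ ∷ u) (there x∈)    = path-suffix p u x∈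

  -- Loop erasure.
  simple-path : ∀ {x y} → Star R x y → ∃[ xs ] Path R x y xs × Unique (x ∷ xs)
  simple-path ε = [] , [] , [] ∷ []
  simple-path {x} (_◅_ {j = y} r rs) with simple-path rs
  ... | ys , p , u with DecMembership._∈?_ Fin._≟_ x (y ∷ ys)
  ...   | yes x∈ = path-suffix p u x∈
  ...   | no  x∉ = _ , r ∷ p , ¬Any⇒All¬ _ x∉ ∷ u

  path-All : ∀ {p} {P : Fin n → Set p} → (∀ {x y} → R x y → P y) →
             ∀ {x y xs} → Path R x y xs → All P xs
  path-All f []      = []
  path-All f (r ∷ p) = f r ∷ path-All f p

  Star-closed : ∀ {p} (P : Fin n → Set p) → (∀ {x y} → R x y → P x → P y) →
                ∀ {x y} → Star R x y → P x → P y
  Star-closed P step ε        px = px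
  Star-closed P step (r ◅ rs) px = Star-closed P step rs (step r px)

module _ (G : Graph n) where
  open Graph G renaming (sym to adj-sym; irrefl to adj-irrefl)

  -- Connected vertex sets and the removal of an edge

  InducedMinus-sym : ∀ {S p q x y} → InducedMinus G S p q x y → InducedMinus G S p q y x
  InducedMinus-sym ((x∈S , y∈S , a) , ≢pq , ≢qp) =
    (y∈S , x∈S , adj-sym a) , (λ (e , f) → ≢qp (f , e)) , (λ (e , f) → ≢pq (f , e))

  InducedMinus-swap : ∀ {S p q x y} → InducedMinus G S p q x y → InducedMinus G S q p x y
  InducedMinus-swap (r , ≢pq , ≢qp) = r , ≢qp , ≢pq

  adj⇒≢ : ∀ {x y} → Adj x y → x ≢ y
  adj⇒≢ a x≡y = adj-irrefl x≡y a

  -- A step of G[S] either crosses the edge pq or survives its removal.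
  cut-step : ∀ {S x y} p q → Induced G S x y →
             (x ≡ p × y ≡ q) ⊎ (x ≡ q × y ≡ p) ⊎ InducedMinus G S p q x y
  cut-step {x = x} {y} p q r with (x Fin.≟ p) ×-dec (y Fin.≟ q) | (x Fin.≟ q) ×-dec (y Fin.≟ p)
  ... | yes e | _     = inj₁ e
  ... | no _  | yes e = inj₂ (inj₁ e)
  ... | no ≢₁ | no ≢₂ = inj₂ (inj₂ (r , ≢₁ , ≢₂))

  some-edge : ∀ {S} → ConnectedOn G S → 2 ℕ.≤ ∣ S ∣ → ∃[ p ] ∃[ q ] Induced G S p q
  some-edge conn 2≤∣S∣ with two-elements 2≤∣S∣
  ... | x , y , x∈S , y∈S , x≢y with conn x∈S y∈S
  ...   | ε     = contradiction ≡.refl x≢y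
  ...   | r ◅ _ = _ , _ , r

  path-Linked : ∀ {ℓ} {R : Rel (Fin n) ℓ} → (∀ {x y} → R x y → Adj x y) →
                ∀ {x y z xs} → Path R x y xs → Adj y z → Linked Adj (x ∷ (xs ∷ʳ z))
  path-Linked f []      a = a ∷ [-]
  path-Linked f (r ∷ p) a = f r ∷ path-Linked f p a

  path-Walk : ∀ {ℓ} {R : Rel (Fin n) ℓ} → (∀ {x y} → R x y → Adj x y) →
              ∀ {x y xs} → Path R x y xs → Walk G x y (length xs)
  path-Walk f []      = []
  path-Walk f (r ∷ p) = f r ∷ path-Walk f p

  -- A simple path inside S visits each vertex of S at most once.
  distance≤∣S∣-1 : ∀ {S} → ConnectedOn G S → ∀ {x y} → x ∈ S → y ∈ S →
                   ∀ {k} → IsDistance G x y k → k ℕ.≤ ∣ S ∣ ℕ.∸ 1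
  distance≤∣S∣-1 conn x∈S y∈S (_ , shortest) =
    let (xs , p , u) = simple-path (conn x∈S y∈S)
    in ℕ.≤-trans (shortest _ (path-Walk (λ (_ , _ , a) → a) p))
         (ℕ.∸-monoˡ-≤ 1 (Unique⇒length≤∣p∣ u (x∈S ∷ path-All (λ (_ , y∈S , _) → y∈S) p)))

  adj⇒distance1 : ∀ {x y} → Adj x y → IsDistance G x y 1
  adj⇒distance1 {x} {y} a = a ∷ [] , positive
    where
    positive : ∀ l → Walk G x y l → 1 ℕ.≤ l
    positive _ []      = contradiction a (adj-irrefl ≡.refl)
    positive _ (_ ∷ _) = s≤s z≤n

  -- Removing the edge pq splits S into the disjoint connected parts A, the
  -- side of p, and B, the side of q, and pq is the only edge between them.
  record EdgeCut (S : Subset n) (p q : Fin n) (A B : Subset n) : Set where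
    field
      adj      : Adj p q
      p∈A      : p ∈ A
      q∈B      : q ∈ B
      A⊆S      : A ⊆ S
      B⊆S      : B ⊆ S
      cover    : ∀ {x} → x ∈ S → x ∈ A ⊎ x ∈ B
      disjoint : ∀ {x} → x ∈ A → x ∉ B
      crossing : ∀ {x y} → x ∈ A → y ∈ B → Adj x y → x ≡ p × y ≡ q
      A-conn   : ConnectedOn G A
      B-conn   : ConnectedOn G B

    ∣S∣≡∣A∣+∣B∣ : ∣ S ∣ ≡ ∣ A ∣ ℕ.+ ∣ B ∣
    ∣S∣≡∣A∣+∣B∣ = ≡.trans (ℕ.≤-antisym (p⊆q⇒∣p∣≤∣q∣ (x∈p∪q⁺ ∘ cover)) (p⊆q⇒∣p∣≤∣q∣ ∪⊆S))
                        (∣disjoint∪∣ disjoint)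
      where
      ∪⊆S : A ∪ B ⊆ S
      ∪⊆S x∈ with x∈p∪q⁻ A B x∈
      ... | inj₁ x∈A = A⊆S x∈A
      ... | inj₂ x∈B = B⊆S x∈B

  EdgeCut-swap : ∀ {S p q A B} → EdgeCut S p q A B → EdgeCut S q p B A
  EdgeCut-swap cut = record
    { adj      = adj-sym adj
    ; p∈A      = q∈B
    ; q∈B      = p∈A
    ; A⊆S      = B⊆S
    ; B⊆S      = A⊆S
    ; cover    = λ x∈S → Sum.swap (cover x∈S)
    ; disjoint = λ x∈B x∈A → disjoint x∈A x∈B
    ; crossing = λ x∈B y∈A a → Product.swap (crossing y∈A x∈B (adj-sym a))
    ; A-conn   = B-conn
    ; B-conn   = A-conn
    }
    where
    open EdgeCut cut

  -- With Δ = 1 + δ: the integral form of |A| - 1 ≤ (1 - 1/Δ)(|S| - 1).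
  Light : ℕ → (S A : Subset n) → Set
  Light δ S A = suc δ ℕ.* (∣ A ∣ ℕ.∸ 1) ℕ.≤ δ ℕ.* (∣ S ∣ ℕ.∸ 1)

  BalancedCut : ℕ → Subset n → Set
  BalancedCut δ S =
    ∃[ p ] ∃[ q ] ∃[ A ] ∃[ B ] EdgeCut S p q A B × Light δ S A × Light δ S B

  -- Since |A| - 1 + |B| = |S| - 1, a side is light if the opposite side has at
  -- least (|S| - 1) / Δ vertices.
  opposite-light : ∀ δ {S p q A B} → EdgeCut S p q A B →
                   ∣ S ∣ ℕ.∸ 1 ℕ.≤ suc δ ℕ.* ∣ B ∣ → Light δ S A
  opposite-light δ {S} {A = A} {B} cut heavy = go ∣ A ∣ ≡.refl
    where
    go : ∀ a → ∣ A ∣ ≡ a → suc δ ℕ.* (a ℕ.∸ 1) ℕ.≤ δ ℕ.* (∣ S ∣ ℕ.∸ 1)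
    go zero    _       = ≡.subst (ℕ._≤ δ ℕ.* (∣ S ∣ ℕ.∸ 1)) (≡.sym (ℕ.*-zeroʳ δ)) z≤n
    go (suc a) ∣A∣≡1+a = ℕ.+-cancelʳ-≤ m _ _ (begin
      suc δ ℕ.* a ℕ.+ m                    ≤⟨ ℕ.+-monoʳ-≤ (suc δ ℕ.* a) heavy ⟩
      suc δ ℕ.* a ℕ.+ suc δ ℕ.* ∣ B ∣      ≡⟨ ℕ.*-distribˡ-+ (suc δ) a ∣ B ∣ ⟨
      suc δ ℕ.* (a ℕ.+ ∣ B ∣)              ≡⟨ ≡.cong (suc δ ℕ.*_) m≡ ⟨
      suc δ ℕ.* m                          ≡⟨ ℕ.+-comm m (δ ℕ.* m) ⟩
      δ ℕ.* m ℕ.+ m                        ∎)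
      where
      open ℕ.≤-Reasoning
      m = ∣ S ∣ ℕ.∸ 1
      m≡ : m ≡ a ℕ.+ ∣ B ∣
      m≡ = ≡.cong (ℕ._∸ 1) (≡.trans (EdgeCut.∣S∣≡∣A∣+∣B∣ cut) (≡.cong (ℕ._+ ∣ B ∣) ∣A∣≡1+a))

  light-half : ∀ {δ S p q A B} → 1 ℕ.≤ δ → EdgeCut S p q A B → ∣ A ∣ ℕ.≤ ∣ B ∣ → Light δ S A
  light-half {δ} {S} {A = A} {B} 1≤δ cut ∣A∣≤∣B∣ = opposite-light δ cut (begin
    ∣ S ∣ ℕ.∸ 1           ≤⟨ ℕ.m∸n≤m ∣ S ∣ 1 ⟩
    ∣ S ∣                 ≡⟨ EdgeCut.∣S∣≡∣A∣+∣B∣ cut ⟩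
    ∣ A ∣ ℕ.+ ∣ B ∣       ≤⟨ ℕ.+-monoˡ-≤ ∣ B ∣ ∣A∣≤∣B∣ ⟩
    ∣ B ∣ ℕ.+ ∣ B ∣       ≡⟨ ≡.cong (∣ B ∣ ℕ.+_) (ℕ.*-identityˡ ∣ B ∣) ⟨
    ∣ B ∣ ℕ.+ 1 ℕ.* ∣ B ∣ ≤⟨ ℕ.+-monoʳ-≤ ∣ B ∣ (ℕ.*-monoˡ-≤ ∣ B ∣ 1≤δ) ⟩
    suc δ ℕ.* ∣ B ∣       ∎)
    where open ℕ.≤-Reasoning

  -- Any path in G[S] - pq from a component stays in that component.
  component-connected : ∀ {S p q x A} → IsComponentOf (InducedMinus G S p q) x A → ConnectedOn G A
  component-connected {S} {p} {q} {x} {A} comp {y} {z} y∈A z∈A =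
    lift y∈A (Star.reverse InducedMinus-sym (to (comp y) y∈A) ◅◅ to (comp z) z∈A)
    where
    open Equivalence
    lift : ∀ {y z} → y ∈ A → Star (InducedMinus G S p q) y z → Star (Induced G A) y z
    lift y∈A ε = ε
    lift {y} y∈A (_◅_ {j = y′} r@((_ , _ , a) , _) rs) =
      let y′∈A = from (comp y′) (to (comp y) y∈A ◅◅ Star.return r)
      in (y∈A , y′∈A , a) ◅ lift y′∈A rs

  component-⊆ : ∀ {S p q x A} → x ∈ S → IsComponentOf (InducedMinus G S p q) x A → A ⊆ S
  component-⊆ {S} x∈S comp {y} y∈A =
    Star-closed (_∈ S) (λ ((_ , y∈S , _) , _) _ → y∈S) (Equivalence.to (comp y) y∈A) x∈S

  module _ (acyclic : Acyclic G) where

    -- A detour around the edge pq would close a cycle.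
    bridge : ∀ {S p q} → Adj p q → ¬ Star (InducedMinus G S p q) p q
    bridge adj path with simple-path path
    ... | []        , []                , _ = adj-irrefl ≡.refl adj
    ... | _ ∷ []    , (_ , ≢pq , _) ∷ [] , _ = ≢pq (≡.refl , ≡.refl)
    ... | _ ∷ _ ∷ _ , p , u = acyclic _ _ (s≤s (s≤s z≤n)) u
          (path-Linked (λ ((_ , _ , a) , _) → a) p (adj-sym adj))

    components⇒EdgeCut : ∀ {S p q A B} → ConnectedOn G S → Induced G S p q →
      IsComponentOf (InducedMinus G S p q) p A →
      IsComponentOf (InducedMinus G S p q) q B → EdgeCut S p q A B
    components⇒EdgeCut {S} {p} {q} {A} {B} conn (p∈S , q∈S , adj) compA compB = record
      { adj      = adj
      ; p∈A      = p∈A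
      ; q∈B      = q∈B
      ; A⊆S      = A⊆S
      ; B⊆S      = B⊆S
      ; cover    = λ x∈S → Star-closed (λ x → x ∈ A ⊎ x ∈ B) step (conn p∈S x∈S) (inj₁ p∈A)
      ; disjoint = disjoint
      ; crossing = crossing
      ; A-conn   = component-connected compA
      ; B-conn   = component-connected compB
      }
      where
      open Equivalence
      p∈A = from (compA p) ε
      q∈B = from (compB q) ε
      A⊆S = component-⊆ p∈S compA
      B⊆S = component-⊆ q∈S compB
      step : ∀ {x y} → Induced G S x y → x ∈ A ⊎ x ∈ B → y ∈ A ⊎ y ∈ B
      step {x} {y} r x∈ with cut-step p q r | x∈
      ... | inj₁ (_ , ≡.refl)        | _        = inj₂ q∈B
      ... | inj₂ (inj₁ (_ , ≡.refl)) | _        = inj₁ p∈A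
      ... | inj₂ (inj₂ r′)           | inj₁ x∈A =
        inj₁ (from (compA y) (to (compA x) x∈A ◅◅ Star.return r′))
      ... | inj₂ (inj₂ r′)           | inj₂ x∈B =
        inj₂ (from (compB y) (to (compB x) x∈B ◅◅ Star.return r′))
      disjoint : ∀ {x} → x ∈ A → x ∉ B
      disjoint {x} x∈A x∈B = bridge adj
        (to (compA x) x∈A ◅◅ Star.reverse InducedMinus-sym (to (compB x) x∈B))
      crossing : ∀ {x y} → x ∈ A → y ∈ B → Adj x y → x ≡ p × y ≡ q
      crossing {x} {y} x∈A y∈B a with cut-step p q (A⊆S x∈A , B⊆S y∈B , a)
      ... | inj₁ e                        = e
      ... | inj₂ (inj₁ (≡.refl , ≡.refl)) = contradiction q∈B (disjoint x∈A)
      ... | inj₂ (inj₂ r)                 = contradiction y∈B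
        (disjoint (from (compA y) (to (compA x) x∈A ◅◅ Star.return r)))

    -- Balanced edges, given a decision procedure for reachability in each
    -- G[S] - pq
    module _ {S : Subset n} (conn : ConnectedOn G S)
      (reach? : ∀ p q y → Dec (Star (InducedMinus G S p q) q y)) where

      -- The component of q in G[S] - pq.
      side : Fin n → Fin n → Subset n
      side p q = comprehension (reach? p q)

      side-component : ∀ p q → IsComponentOf (InducedMinus G S p q) q (side p q)
      side-component p q y = mk⇔ (comprehension⁻ (reach? p q)) (comprehension⁺ (reach? p q))

      side-component′ : ∀ p q → IsComponentOf (InducedMinus G S p q) p (side q p)
      side-component′ p q y = mk⇔
        (Star.map InducedMinus-swap ∘ comprehension⁻ (reach? q p))
        (comprehension⁺ (reach? q p) ∘ Star.map InducedMinus-swap)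

      side-cut : ∀ {p q} → Induced G S p q → EdgeCut S p q (side q p) (side p q)
      side-cut {p} {q} r = components⇒EdgeCut conn r (side-component′ p q) (side-component p q)

      -- The branch of the side of q at a neighbour c of q avoids q, because c
      -- and q are disconnected in G[S] - qc; in particular it avoids pq.
      side-⊆ : ∀ {p q c} → Induced G S p q → Induced G S q c → c ≢ p → side q c ⊆ side p q ∖ q
      side-⊆ {p} {q} {c} pq qc@(q∈S , c∈S , a) c≢p {y} y∈ =
        proj₂ (Star-closed (λ x → Star (InducedMinus G S q c) c x × x ∈ side p q ∖ q)
                           step (comprehension⁻ (reach? q c) y∈) (ε , c∈side))
        where
        add : ∀ {y} → Star (InducedMinus G S p q) q y → y ≢ q → y ∈ side p q ∖ q
        add s y≢q = x∈p∧x≢y⇒x∈p-y (comprehension⁺ (reach? p q) s) y≢q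
        c∈side : c ∈ side p q ∖ q
        c∈side = add
          ((qc , (λ (_ , c≡q) → adj⇒≢ a (≡.sym c≡q)) , λ (_ , c≡p) → c≢p c≡p) ◅ ε)
          (λ c≡q → adj⇒≢ a (≡.sym c≡q))
        step : ∀ {x y} → InducedMinus G S q c x y →
               Star (InducedMinus G S q c) c x × x ∈ side p q ∖ q →
               Star (InducedMinus G S q c) c y × y ∈ side p q ∖ q
        step {x} {y} r (s , x∈) = s ◅◅ Star.return r , add
          (comprehension⁻ (reach? p q) (p─q⊆p (side p q) ⁅ q ⁆ x∈) ◅◅ Star.return
            (proj₁ r , (λ (_ , y≡q) → y≢q y≡q) ,
                     (λ (x≡q , _) → ∈-remove⇒≢ {p = side p q} x∈ x≡q)))
          y≢q
          where
          y≢q : y ≢ q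
          y≢q ≡.refl = bridge a (Star.reverse InducedMinus-sym (s ◅◅ Star.return r))

      forward? : ∀ p q c → Dec (Adj q c × c ∈ S × c ≢ p)
      forward? p q c = (adj? q c) ×-dec (c ∈? S) ×-dec ¬? (c Fin.≟ p)

      -- The neighbours of q in S on the far side of the edge pq.
      forward : Fin n → Fin n → Subset n
      forward p q = comprehension (forward? p q)

      ∈-forward⁻ : ∀ {p q c} → c ∈ forward p q → Adj q c × c ∈ S × c ≢ p
      ∈-forward⁻ {p} {q} = comprehension⁻ (forward? p q)

      ∣forward∣<degree : ∀ {p q} → Adj p q → ∣ forward p q ∣ ℕ.< degree G q
      ∣forward∣<degree {p} {q} a = p⊂q⇒∣p∣<∣q∣
        ( (λ c∈ → comprehension⁺ (adj? q) (proj₁ (∈-forward⁻ c∈)))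
        , p , comprehension⁺ (adj? q) (adj-sym a)
        , λ p∈ → proj₂ (proj₂ (∈-forward⁻ p∈)) ≡.refl)

      -- Apart from q, the side of q consists of its branches.
      side-cover : ∀ {p q} → q ∈ S → ∀ {x} → x ∈ side p q ∖ q →
                   ∃[ c ] c ∈ forward p q × x ∈ side q c
      side-cover {p} {q} q∈S {x} x∈
        with Star-closed (λ x → x ≡ q ⊎ ∃[ c ] c ∈ forward p q × x ∈ side q c) step
               (comprehension⁻ (reach? p q) (p─q⊆p (side p q) ⁅ q ⁆ x∈)) (inj₁ ≡.refl)
        where
        step : ∀ {x y} → InducedMinus G S p q x y →
               x ≡ q ⊎ ∃[ c ] c ∈ forward p q × x ∈ side q c →
               y ≡ q ⊎ ∃[ c ] c ∈ forward p q × y ∈ side q c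
        step {x} {y} ((x∈S , y∈S , a) , _ , ≢qp) (inj₁ ≡.refl) = inj₂
          ( y
          , comprehension⁺ (forward? p q) (a , y∈S , λ y≡p → ≢qp (≡.refl , y≡p))
          , comprehension⁺ (reach? q y) ε)
        step {x} {y} (r , _) (inj₂ (c , c∈ , x∈)) with cut-step q c r
        ... | inj₁ (_ , ≡.refl)     = inj₂ (c , c∈ , comprehension⁺ (reach? q c) ε)
        ... | inj₂ (inj₁ (_ , y≡q)) = inj₁ y≡q
        ... | inj₂ (inj₂ r′)        =
          inj₂ (c , c∈ , comprehension⁺ (reach? q c)
            (comprehension⁻ (reach? q c) x∈ ◅◅ Star.return r′))
      ... | inj₁ x≡q = contradiction x≡q (∈-remove⇒≢ {p = side p q} x∈)
      ... | inj₂ c∈  = c∈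

      module _ {δ : ℕ} (1≤δ : 1 ℕ.≤ δ) (maxDegree : MaxDegree≤ G (suc δ)) where

        -- The search for a balanced edge; k bounds the size of the shrinking
        -- side of q.
        descend : ∀ k {p q} → Induced G S p q → ∣ side p q ∣ ℕ.≤ k → Light δ S (side q p) →
                  BalancedCut δ S
        descend zero    {p} {q} r ≤0 _ =
          contradiction (ℕ.≤-trans (x∈p⇒1≤∣p∣ (EdgeCut.q∈B (side-cut r))) ≤0) λ ()
        descend (suc k) {p} {q} r@(p∈S , q∈S , a) ≤1+k light
          with suc δ ℕ.* (∣ side p q ∣ ℕ.∸ 1) ℕ.≤? δ ℕ.* (∣ S ∣ ℕ.∸ 1)
             | Fin.any? (λ c → (c ∈? forward p q) ×-dec (∣ S ∣ ℕ.∸ 1 ℕ.≤? suc δ ℕ.* ∣ side q c ∣))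
        ... | yes light′ | _ = p , q , side q p , side p q , side-cut r , light , light′
        -- A heavy branch at c: continue with the edge qc.
        ... | no _ | yes (c , c∈ , heavy) =
          let (b , c∈S , c≢p) = ∈-forward⁻ c∈
              r′ = q∈S , c∈S , b
          in descend k r′
               (ℕ.s≤s⁻¹ (ℕ.≤-trans
                 (ℕ.≤-<-trans (p⊆q⇒∣p∣≤∣q∣ (side-⊆ r r′ c≢p))
                              (x∈p⇒∣p-x∣<∣p∣ (EdgeCut.q∈B (side-cut r)))) ≤1+k))
               (opposite-light δ (side-cut r′) heavy)
        -- Without a heavy branch, the at most δ branches are too small to make
        -- the side of q heavy.
        ... | no heavy | no none = contradiction (begin
          suc δ ℕ.* (∣ side p q ∣ ℕ.∸ 1)
            ≤⟨ ℕ.*-monoʳ-≤ (suc δ) (ℕ.∸-monoˡ-≤ 1 (∣p∣≤1+∣p-x∣ (side p q) q)) ⟩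
          suc δ ℕ.* ∣ side p q ∖ q ∣
            ≤⟨ covered⇒*∣T∣≤ (suc δ) (∣ S ∣ ℕ.∸ 1) δ (side q) (forward p q) (side p q ∖ q)
                 (ℕ.s≤s⁻¹ (ℕ.≤-trans (∣forward∣<degree a) (maxDegree q)))
                 (λ {c} c∈ → ℕ.<⇒≤ (ℕ.≰⇒> λ heavy-c → none (c , c∈ , heavy-c)))
                 (side-cover q∈S) ⟩
          δ ℕ.* (∣ S ∣ ℕ.∸ 1) ∎) heavy
          where open ℕ.≤-Reasoning

        -- The search starts at any edge, directed towards its larger side.
        balanced-cut : 2 ℕ.≤ ∣ S ∣ → BalancedCut δ S
        balanced-cut 2≤∣S∣ with some-edge conn 2≤∣S∣
        ... | p , q , r@(p∈S , q∈S , a) with ℕ.≤-total ∣ side q p ∣ ∣ side p q ∣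
        ...   | inj₁ ≤ = descend _ r ℕ.≤-refl (light-half 1≤δ (side-cut r) ≤)
        ...   | inj₂ ≥ = descend _ r′ ℕ.≤-refl (light-half 1≤δ (side-cut r′) ≥)
          where r′ = q∈S , p∈S , adj-sym a

    ¬¬-reach? : ∀ (S : Subset n) → ¬ ¬ (∀ p q y → Dec (Star (InducedMinus G S p q) q y))
    ¬¬-reach? S = ¬¬-∀ λ p → ¬¬-∀ λ q → ¬¬-∀ λ y → ¬¬-excluded-middle

    ¬¬-edge-cut : ∀ {S} → ConnectedOn G S → 2 ℕ.≤ ∣ S ∣ →
                  ¬ ¬ (∃[ p ] ∃[ q ] ∃[ A ] ∃[ B ] EdgeCut S p q A B)
    ¬¬-edge-cut {S} conn 2≤∣S∣ = ¬¬-map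
      (λ reach? → let (p , q , r) = some-edge conn 2≤∣S∣ in p , q , _ , _ , side-cut conn reach? r)
      (¬¬-reach? S)

    ¬¬-balanced-cut : ∀ {δ S} → 1 ℕ.≤ δ → MaxDegree≤ G (suc δ) → ConnectedOn G S → 2 ℕ.≤ ∣ S ∣ →
                      ¬ ¬ BalancedCut δ S
    ¬¬-balanced-cut {S = S} 1≤δ maxDegree conn 2≤∣S∣ = ¬¬-map
      (λ reach? → balanced-cut conn reach? 1≤δ maxDegree 2≤∣S∣) (¬¬-reach? S)

-- Ordered field arithmetic

module OrderedField {c ℓ₁ ℓ₂} (ℝ : Reals c ℓ₁ ℓ₂) where
  open Reals ℝ
  open CommutativeRing commutativeRing
    using (refl; sym; trans; setoid; +-cong; +-congˡ; +-congʳ; *-cong; *-congˡ; *-congʳ;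
           +-comm; +-assoc; +-identityˡ; +-identityʳ; -‿inverseʳ; -‿inverseˡ; -‿cong; zeroˡ; zeroʳ;
           *-comm; *-assoc; *-identityˡ; *-identityʳ; distribˡ; distribʳ; commutativeSemiring)
    public
  open IsStrictPartialOrder isStrictPartialOrder
    using (<-respˡ-≈; <-respʳ-≈) renaming (irrefl to <-irrefl; asym to <-asym) public
  open SemiringSum semiring using (sum-cong-≋; ∑-distrib-+; sum-replicate-zero) public
  open SemiringMult semiring using (×-homo-+; ×1-homo-*) public
  module Solve = NaturalCoefficients commutativeSemiring

  <⇒≤ : ∀ {x y} → x < y → x ≤ y
  <⇒≤ x<y y<x = <-asym x<y y<x

  ≤-reflexive : ∀ {x y} → x ≈ y → x ≤ y
  ≤-reflexive x≈y y<x = <-irrefl (sym x≈y) y<x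

  ≤-refl : ∀ {x} → x ≤ x
  ≤-refl = ≤-reflexive refl

  <-≤-trans : ∀ {x y z} → x < y → y ≤ z → x < z
  <-≤-trans {z = z} x<y y≤z with <-cotrans x<y z
  ... | inj₁ x<z = x<z
  ... | inj₂ z<y = contradiction z<y y≤z

  ≤-trans : ∀ {x y z} → x ≤ y → y ≤ z → x ≤ z
  ≤-trans x≤y y≤z z<x = y≤z (<-≤-trans z<x x≤y)

  ≤-respˡ : ∀ {x y z} → x ≈ y → x ≤ z → y ≤ z
  ≤-respˡ x≈y = ≤-trans (≤-reflexive (sym x≈y))

  ≤-respʳ : ∀ {x y z} → y ≈ z → x ≤ y → x ≤ z
  ≤-respʳ y≈z x≤y = ≤-trans x≤y (≤-reflexive y≈z)

  add-sub-cancel : ∀ x z → x + z + - z ≈ x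
  add-sub-cancel x z = trans (+-assoc x z (- z)) (trans (+-congˡ (-‿inverseʳ z)) (+-identityʳ x))

  sub-add-cancel : ∀ x z → x - z + z ≈ x
  sub-add-cancel x z = trans (+-assoc x (- z) z) (trans (+-congˡ (-‿inverseˡ z)) (+-identityʳ x))

  +-monoˡ-≤ : ∀ z {x y} → x ≤ y → x + z ≤ y + z
  +-monoˡ-≤ z x≤y y+z<x+z = x≤y
    (<-respˡ-≈ (add-sub-cancel _ z) (<-respʳ-≈ (add-sub-cancel _ z) (+-monoˡ-< (- z) y+z<x+z)))

  +-mono-≤ : ∀ {x y u v} → x ≤ y → u ≤ v → x + u ≤ y + v
  +-mono-≤ {x} {y} {u} {v} x≤y u≤v = ≤-trans (+-monoˡ-≤ u x≤y)
    (≤-respˡ (+-comm u y) (≤-respʳ (+-comm v y) (+-monoˡ-≤ y u≤v)))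

  ≤-+-nonneg : ∀ {x y} → 0# ≤ y → x ≤ x + y
  ≤-+-nonneg {x} 0≤y = ≤-respˡ (+-identityʳ x) (+-mono-≤ ≤-refl 0≤y)

  x≤y⇒0≤y-x : ∀ {x y} → x ≤ y → 0# ≤ y - x
  x≤y⇒0≤y-x {x} x≤y = ≤-respˡ (-‿inverseʳ x) (+-monoˡ-≤ (- x) x≤y)

  -- If x y < 0, then neither factor is zero.  By tightness 0 < y is irrefutable,
  -- so 0 < x is impossible, and by tightness again x would be zero.
  0≤* : ∀ {x y} → 0# ≤ x → 0# ≤ y → 0# ≤ x * y
  0≤* {x} {y} 0≤x 0≤y xy<0 = zero-x (<-tight ¬0<x 0≤x)
    where
    zero-x : ¬ 0# ≈ x
    zero-x 0≈x = <-irrefl (trans (*-congʳ (sym 0≈x)) (zeroˡ y)) xy<0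
    zero-y : ¬ 0# ≈ y
    zero-y 0≈y = <-irrefl (trans (*-congˡ (sym 0≈y)) (zeroʳ x)) xy<0
    ¬0<x : ¬ 0# < x
    ¬0<x 0<x = zero-y (<-tight (λ 0<y → <-asym (*-pos 0<x 0<y) xy<0) 0≤y)

  *-monoˡ-≤ : ∀ {z x y} → 0# ≤ z → x ≤ y → z * x ≤ z * y
  *-monoˡ-≤ {z} {x} {y} 0≤z x≤y = ≤-respˡ (+-identityˡ (z * x))
    (≤-respʳ (trans (sym (distribˡ z (y - x) x)) (*-congˡ (sub-add-cancel y x)))
      (+-monoˡ-≤ (z * x) (0≤* 0≤z (x≤y⇒0≤y-x x≤y))))

  *-monoʳ-≤ : ∀ {z x y} → 0# ≤ z → x ≤ y → x * z ≤ y * z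
  *-monoʳ-≤ 0≤z x≤y = ≤-respˡ (*-comm _ _) (≤-respʳ (*-comm _ _) (*-monoˡ-≤ 0≤z x≤y))

  *-monoˡ-< : ∀ {z x y} → 0# < z → x < y → z * x < z * y
  *-monoˡ-< {z} {x} {y} 0<z x<y = <-respˡ-≈ (+-identityˡ (z * x))
    (<-respʳ-≈ (trans (sym (distribˡ z (y - x) x)) (*-congˡ (sub-add-cancel y x)))
      (+-monoˡ-< (z * x) (*-pos 0<z (<-respˡ-≈ (-‿inverseʳ x) (+-monoˡ-< (- x) x<y)))))

  *-cancelˡ-≤ : ∀ {z x y} → 0# < z → z * x ≤ z * y → x ≤ y
  *-cancelˡ-≤ 0<z zx≤zy y<x = zx≤zy (*-monoˡ-< 0<z y<x)

  *-/-cancel : ∀ x y {z} (z#0 : z # 0#) → z * (x * (y / z ⟨ z#0 ⟩)) ≈ x * y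
  *-/-cancel x y {z} z#0 = trans
    (Solve.solve 4 (λ z x y i → z :* (x :* (y :* i)) := (z :* i) :* (x :* y)) refl z x y (inv z z#0))
    (trans (*-congʳ (inverseʳ z z#0)) (*-identityˡ (x * y)))
    where open Solve

  /-cancel : ∀ y {z} (z#0 : z # 0#) → z * (y / z ⟨ z#0 ⟩) ≈ y
  /-cancel y {z} z#0 = trans (*-congˡ (sym (*-identityˡ _))) (trans (*-/-cancel 1# y z#0) (*-identityˡ y))

  0≤fromℕ : ∀ m → 0# ≤ fromℕ m
  0≤fromℕ zero    = ≤-refl
  0≤fromℕ (suc m) = <⇒≤ (fromℕ>0 {suc m} (s≤s z≤n))

  fromℕ-mono : ∀ {l m} → l ℕ.≤ m → fromℕ l ≤ fromℕ m
  fromℕ-mono {m = m} z≤n = 0≤fromℕ m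
  fromℕ-mono (s≤s l≤m)   = +-mono-≤ ≤-refl (fromℕ-mono l≤m)

  fromℕ-1 : fromℕ 1 ≈ 1#
  fromℕ-1 = +-identityʳ 1#

  fromℕ-homo-+ : ∀ l m → fromℕ (l ℕ.+ m) ≈ fromℕ l + fromℕ m
  fromℕ-homo-+ = ×-homo-+ 1#

  fromℕ-homo-* : ∀ l m → fromℕ (l ℕ.* m) ≈ fromℕ l * fromℕ m
  fromℕ-homo-* = ×1-homo-*

  fromℕ-≡ : ∀ {l m} → l ≡ m → fromℕ l ≈ fromℕ m
  fromℕ-≡ ≡.refl = refl

  sum-mono : ∀ {n} {f g : Fin n → Carrier} → (∀ i → f i ≤ g i) → sum f ≤ sum g
  sum-mono {zero}  _   = ≤-refl
  sum-mono {suc n} f≤g = +-mono-≤ (f≤g zero) (sum-mono (f≤g ∘ suc))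

  0≤sum : ∀ {n} {f : Fin n → Carrier} → (∀ i → 0# ≤ f i) → 0# ≤ sum f
  0≤sum {n} 0≤f = ≤-respˡ (sum-replicate-zero n) (sum-mono 0≤f)

  term≤sum : ∀ {n} {f : Fin n → Carrier} → (∀ i → 0# ≤ f i) → ∀ i → f i ≤ sum f
  term≤sum 0≤f zero    = ≤-+-nonneg (0≤sum (0≤f ∘ suc))
  term≤sum 0≤f (suc i) = ≤-respˡ (+-identityˡ _) (+-mono-≤ (0≤f zero) (term≤sum (0≤f ∘ suc) i))

  sum-single : ∀ {n} {f : Fin n → Carrier} i → (∀ j → j ≢ i → f j ≈ 0#) → sum f ≈ f i
  sum-single {suc n} zero    f≈0 =
    trans (+-congˡ (trans (sum-cong-≋ λ j → f≈0 (suc j) λ ()) (sum-replicate-zero n))) (+-identityʳ _)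
  sum-single {suc n} (suc i) f≈0 =
    trans (+-cong (f≈0 zero λ ()) (sum-single i λ j j≢i → f≈0 (suc j) λ { ≡.refl → j≢i ≡.refl }))
          (+-identityˡ _)

-- Lowest common ancestors and heights

module _ {n : ℕ} where
  open DecMembership (Fin._≟_ {n}) using () renaming (_∈?_ to _∈ˡ?_)

  height-≢ : ∀ (H : BinaryTree {n}) {x y} → x ≢ y →
             height H x y ≡ length (leaves (lca H x y)) ℕ.∸ 1
  height-≢ H {x} {y} x≢y rewrite dec-false (x Fin.≟ y) x≢y = ≡.refl

  height-cong : ∀ (H K : BinaryTree {n}) {x y} → lca H x y ≡ lca K x y → height H x y ≡ height K x y
  height-cong H K {x} {y} eq =
    ≡.cong (λ L → if does (x Fin.≟ y) then 0 else length (leaves L) ℕ.∸ 1) eq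

  module _ (l r : BinaryTree {n}) {x y : Fin n} where

    lca-left : x ∈ˡ leaves l → y ∈ˡ leaves l → lca (node l tt r) x y ≡ lca l x y
    lca-left x∈ y∈
      rewrite dec-true (x ∈ˡ? leaves l) x∈ | dec-true (y ∈ˡ? leaves l) y∈ = ≡.refl

    lca-right : x ∉ˡ leaves l → x ∈ˡ leaves r → y ∈ˡ leaves r → lca (node l tt r) x y ≡ lca r x y
    lca-right x∉ x∈ y∈
      rewrite dec-false (x ∈ˡ? leaves l) x∉
            | dec-true (x ∈ˡ? leaves r) x∈ | dec-true (y ∈ˡ? leaves r) y∈ = ≡.refl

    lca-cross-lr : y ∉ˡ leaves l → x ∉ˡ leaves r → lca (node l tt r) x y ≡ node l tt r
    lca-cross-lr y∉ x∉
      rewrite dec-false ((x ∈ˡ? leaves l) ×-dec (y ∈ˡ? leaves l)) (y∉ ∘ proj₂)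
            | dec-false (x ∈ˡ? leaves r) x∉ = ≡.refl

    lca-cross-rl : x ∉ˡ leaves l → y ∉ˡ leaves r → lca (node l tt r) x y ≡ node l tt r
    lca-cross-rl x∉ y∉
      rewrite dec-false (x ∈ˡ? leaves l) x∉
            | dec-false ((x ∈ˡ? leaves r) ×-dec (y ∈ˡ? leaves r)) (y∉ ∘ proj₂) = ≡.refl

-- Hierarchies on a set of vertices

module _ {n} (G : Graph n) where

  -- The leaves of H are the vertices of S, each once, and h_H ≥ d_G on S.
  record HierarchyOn (S : Subset n) (H : BinaryTree {n}) : Set where
    field
      unique    : Unique (leaves H)
      sound     : ∀ {x} → x ∈ˡ leaves H → x ∈ S
      complete  : ∀ {x} → x ∈ S → x ∈ˡ leaves H
      size      : length (leaves H) ≡ ∣ S ∣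
      dominates : ∀ {x y k} → x ∈ S → y ∈ S → IsDistance G x y k → k ℕ.≤ height H x y

  leaf-hierarchy : ∀ {S x} → ConnectedOn G S → x ∈ S → ∣ S ∣ ≡ 1 → HierarchyOn S (leaf x)
  leaf-hierarchy {S} {x} conn x∈S ∣S∣≡1 = record
    { unique    = [] ∷ []
    ; sound     = λ { (here ≡.refl) → x∈S }
    ; complete  = λ y∈S → here (only y∈S)
    ; size      = ≡.sym ∣S∣≡1
    ; dominates = λ {_} {_} {k} x∈S y∈S dist → ℕ.≤-trans (distance≤∣S∣-1 G conn x∈S y∈S dist)
                    (≡.subst (λ s → s ℕ.∸ 1 ℕ.≤ _) (≡.sym ∣S∣≡1) z≤n)
    }
    where
    only : ∀ {y} → y ∈ S → y ≡ x
    only {y} y∈S with y Fin.≟ x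
    ... | yes y≡x = y≡x
    ... | no  y≢x = contradiction (≡.subst (2 ℕ.≤_) ∣S∣≡1 (distinct⇒2≤∣p∣ y∈S x∈S y≢x)) λ { (s≤s ()) }

  -- The hierarchies l and r on the two parts of an edge cut of S, joined at a
  -- new root.  Heights within a part are unchanged, and the endpoints of a
  -- crossing pair get the height |S| - 1.
  module Join {S p q A B l r} (cut : EdgeCut G S p q A B)
              (hA : HierarchyOn A l) (hB : HierarchyOn B r) where
    open EdgeCut cut
    private
      module hA = HierarchyOn hA
      module hB = HierarchyOn hB

    joined : BinaryTree
    joined = node l tt r

    size : length (leaves joined) ≡ ∣ S ∣
    size = ≡.trans (List.length-++ (leaves l))
      (≡.trans (≡.cong₂ ℕ._+_ hA.size hB.size) (≡.sym ∣S∣≡∣A∣+∣B∣))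

    height-A : ∀ {x y} → x ∈ A → y ∈ A → height joined x y ≡ height l x y
    height-A x∈A y∈A = height-cong joined l (lca-left l r (hA.complete x∈A) (hA.complete y∈A))

    height-B : ∀ {x y} → x ∈ B → y ∈ B → height joined x y ≡ height r x y
    height-B x∈B y∈B = height-cong joined r
      (lca-right l r (λ x∈ → disjoint (hA.sound x∈) x∈B) (hB.complete x∈B) (hB.complete y∈B))

    height-root : ∀ {x y} → x ≢ y → lca joined x y ≡ joined → height joined x y ≡ ∣ S ∣ ℕ.∸ 1
    height-root x≢y lca≡ =
      ≡.trans (height-≢ joined x≢y) (≡.cong (ℕ._∸ 1) (≡.trans (≡.cong (length ∘ leaves) lca≡) size))

    height-AB : ∀ {x y} → x ∈ A → y ∈ B → height joined x y ≡ ∣ S ∣ ℕ.∸ 1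
    height-AB x∈A y∈B = height-root (λ { ≡.refl → disjoint x∈A y∈B })
      (lca-cross-lr l r (λ y∈ → disjoint (hA.sound y∈) y∈B) (disjoint x∈A ∘ hB.sound))

    height-BA : ∀ {x y} → x ∈ B → y ∈ A → height joined x y ≡ ∣ S ∣ ℕ.∸ 1
    height-BA x∈B y∈A = height-root (λ { ≡.refl → disjoint y∈A x∈B })
      (lca-cross-rl l r (λ x∈ → disjoint (hA.sound x∈) x∈B) (disjoint y∈A ∘ hB.sound))

    join : ConnectedOn G S → HierarchyOn S joined
    join conn = record
      { unique    = Unique.++⁺ hA.unique hB.unique λ (x∈l , x∈r) → disjoint (hA.sound x∈l) (hB.sound x∈r)
      ; sound     = λ x∈ → [ A⊆S ∘ hA.sound , B⊆S ∘ hB.sound ]′ (∈-++⁻ (leaves l) x∈)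
      ; complete  = λ x∈S → [ ∈-++⁺ˡ ∘ hA.complete , ∈-++⁺ʳ (leaves l) ∘ hB.complete ]′ (cover x∈S)
      ; size      = size
      ; dominates = dominates
      }
      where
      dominates : ∀ {x y k} → x ∈ S → y ∈ S → IsDistance G x y k → k ℕ.≤ height joined x y
      dominates x∈S y∈S dist with cover x∈S | cover y∈S
      ... | inj₁ x∈A | inj₁ y∈A = ≡.subst (_ ℕ.≤_) (≡.sym (height-A x∈A y∈A))
        (hA.dominates x∈A y∈A dist)
      ... | inj₂ x∈B | inj₂ y∈B = ≡.subst (_ ℕ.≤_) (≡.sym (height-B x∈B y∈B))
        (hB.dominates x∈B y∈B dist)
      ... | inj₁ x∈A | inj₂ y∈B = ≡.subst (_ ℕ.≤_) (≡.sym (height-AB x∈A y∈B))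
        (distance≤∣S∣-1 G conn x∈S y∈S dist)
      ... | inj₂ x∈B | inj₁ y∈A = ≡.subst (_ ℕ.≤_) (≡.sym (height-BA x∈B y∈A))
        (distance≤∣S∣-1 G conn x∈S y∈S dist)

  HierarchyOn-⊤ : ∀ {H} → HierarchyOn ⊤ H → IsHierarchy H
  HierarchyOn-⊤ h = ∼bag⇒↭ (unique∧set⇒bag unique (Unique.allFin⁺ n)
    (mk⇔ (λ _ → ∈-allFin _) (λ _ → complete ∈⊤)))
    where open HierarchyOn h

-- Sums over edges

module _ {c ℓ₁ ℓ₂} (ℝ : Reals c ℓ₁ ℓ₂) where
  open Reals ℝ
  open OrderedField ℝ
  open Weighted ℝ

  module _ {p} {P : Set p} where

    if-mono : ∀ (d : Dec P) {u v} → (P → u ≤ v) →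
              (if does d then u else 0#) ≤ (if does d then v else 0#)
    if-mono (yes p) u≤v = u≤v p
    if-mono (no _)  _   = ≤-refl

    0≤if : ∀ (d : Dec P) {v} → (P → 0# ≤ v) → 0# ≤ (if does d then v else 0#)
    0≤if (yes p) 0≤v = 0≤v p
    0≤if (no _)  _   = ≤-refl

    if-yes : ∀ (d : Dec P) {v} → P → (if does d then v else 0#) ≈ v
    if-yes (yes _) _ = refl
    if-yes (no ¬p) p = contradiction p ¬p

    if-no : ∀ (d : Dec P) {v} → ¬ P → (if does d then v else 0#) ≈ 0#
    if-no (yes p) ¬p = contradiction p ¬p
    if-no (no _)  _  = refl

  -- The indicator of a disjoint union of A, B and E is the sum of theirs.
  if-partition : ∀ {s a b e} {S : Set s} {A : Set a} {B : Set b} {E : Set e}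
    (S? : Dec S) (A? : Dec A) (B? : Dec B) (E? : Dec E) →
    (S → A ⊎ B ⊎ E) → (A → S) → (B → S) → (E → S) →
    (A → ¬ B) → (A → ¬ E) → (B → ¬ E) → ∀ v →
    (if does S? then v else 0#) ≈
      (if does A? then v else 0#) + (if does B? then v else 0#) + (if does E? then v else 0#)
  if-partition (no ¬s) A? B? E? _ A⇒S B⇒S E⇒S _ _ _ v = sym (trans
    (+-cong (+-cong (if-no A? (¬s ∘ A⇒S)) (if-no B? (¬s ∘ B⇒S))) (if-no E? (¬s ∘ E⇒S)))
    (trans (+-identityʳ _) (+-identityʳ _)))
  if-partition (yes s) A? B? E? S⇒ _ _ _ A#B A#E B#E v with S⇒ s
  ... | inj₁ a = sym (trans
    (+-cong (+-cong (if-yes A? a) (if-no B? (A#B a))) (if-no E? (A#E a)))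
    (trans (+-identityʳ _) (+-identityʳ _)))
  ... | inj₂ (inj₁ b) = sym (trans
    (+-cong (+-cong (if-no A? λ a → A#B a b) (if-yes B? b)) (if-no E? (B#E b)))
    (trans (+-identityʳ _) (+-identityˡ _)))
  ... | inj₂ (inj₂ e) = sym (trans
    (+-cong (+-cong (if-no A? λ a → A#E a e) (if-no B? λ b → B#E b e)) (if-yes E? e))
    (trans (+-congʳ (+-identityˡ _)) (+-identityˡ _)))

  module _ {n} (G : WeightedGraph n) where
    open WeightedGraph G
    open Graph graph using () renaming (sym to adj-sym)

    private variable
      S A B : Subset n
      p q   : Fin n

    edge? : ∀ S (x y : Fin n) → Dec (x Fin.< y × x ∈ S × y ∈ S × Adj x y)
    edge? S x y = (x Fin.<? y) ×-dec (x ∈? S) ×-dec (y ∈? S) ×-dec (adj? x y)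

    ∑E-mono : ∀ {f g} → (∀ {x y} → x ∈ S → y ∈ S → Adj x y → f x y ≤ g x y) →
              ∑E[_] G S f ≤ ∑E[_] G S g
    ∑E-mono {S} f≤g = sum-mono λ x → sum-mono λ y →
      if-mono (edge? S x y) λ (_ , x∈S , y∈S , a) → f≤g x∈S y∈S a

    ∑E-zero : ∀ {f} → (∀ {x y} → x ∈ S → y ∈ S → ¬ Adj x y) → ∑E[_] G S f ≈ 0#
    ∑E-zero {S} edgeless = trans
      (sum-cong-≋ λ x → trans
        (sum-cong-≋ λ y → if-no (edge? S x y) λ (_ , x∈S , y∈S , a) → edgeless x∈S y∈S a)
        (sum-replicate-zero n))
      (sum-replicate-zero n)

    0≤w-term : ∀ x y → 0# ≤ (if does (edge? S x y) then w x y else 0#)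
    0≤w-term {S} x y = 0≤if (edge? S x y) λ (_ , _ , _ , a) → <⇒≤ (w-pos a)

    0≤W : ∀ S → 0# ≤ W G S
    0≤W S = 0≤sum λ x → 0≤sum λ y → 0≤w-term {S} x y

    0<W : Induced graph S p q → 0# < W G S
    0<W {S} {p} {q} (p∈S , q∈S , a) with Fin.<-cmp p q
    ... | tri≈ _ p≡q _ = contradiction p≡q (adj⇒≢ graph a)
    ... | tri< p<q _ _ = <-≤-trans (w-pos a)
      (≤-respˡ (if-yes (edge? S p q) (p<q , p∈S , q∈S , a))
        (≤-trans (term≤sum (0≤w-term {S} p) q) (term≤sum (λ x → 0≤sum (0≤w-term {S} x)) p)))
    ... | tri> _ _ q<p = <-≤-trans (w-pos (adj-sym a))
      (≤-respˡ (if-yes (edge? S q p) (q<p , q∈S , p∈S , adj-sym a))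
        (≤-trans (term≤sum (0≤w-term {S} q) p) (term≤sum (λ x → 0≤sum (0≤w-term {S} x)) q)))

    -- The edges of G[S] are those of G[A], those of G[B], and pq.  Edges are
    -- summed with increasing endpoints, whence the hypothesis p < q.
    ∑E-cut-< : ∀ {f} → p Fin.< q → EdgeCut graph S p q A B →
               ∑E[_] G S f ≈ ∑E[_] G A f + ∑E[_] G B f + f p q
    ∑E-cut-< {p} {q} {S} {A} {B} {f} p<q cut = begin
      sum (λ x → sum (λ y → tS x y))
        ≈⟨ sum-cong-≋ (λ x → trans (sum-cong-≋ (partition x)) (distrib (tA x) (tB x) (tE x))) ⟩
      sum (λ x → sum (tA x) + sum (tB x) + sum (tE x))
        ≈⟨ distrib (sum ∘ tA) (sum ∘ tB) (sum ∘ tE) ⟩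
      sum (sum ∘ tA) + sum (sum ∘ tB) + sum (sum ∘ tE)
        ≈⟨ +-congˡ (trans (sum-single p (λ x x≢p → trans
                      (sum-cong-≋ λ y → if-no (E? x y) (x≢p ∘ proj₁)) (sum-replicate-zero n)))
                   (trans (sum-single q (λ y y≢q → if-no (E? p y) (y≢q ∘ proj₂)))
                          (if-yes (E? p q) (≡.refl , ≡.refl)))) ⟩
      sum (sum ∘ tA) + sum (sum ∘ tB) + f p q ∎
      where
      open EdgeCut cut
      open import Relation.Binary.Reasoning.Setoid setoid
      E? : ∀ x y → Dec (x ≡ p × y ≡ q)
      E? x y = (x Fin.≟ p) ×-dec (y Fin.≟ q)
      tS tA tB tE : Fin n → Fin n → Carrier
      tS x y = if does (edge? S x y) then f x y else 0#
      tA x y = if does (edge? A x y) then f x y else 0#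
      tB x y = if does (edge? B x y) then f x y else 0#
      tE x y = if does (E? x y) then f x y else 0#
      distrib : ∀ (a b e : Fin n → Carrier) → sum (λ i → a i + b i + e i) ≈ sum a + sum b + sum e
      distrib a b e = trans (∑-distrib-+ (λ i → a i + b i) e) (+-congʳ (∑-distrib-+ a b))
      partition : ∀ x y → tS x y ≈ tA x y + tB x y + tE x y
      partition x y = if-partition (edge? S x y) (edge? A x y) (edge? B x y) (E? x y)
        S⇒
        (λ (lt , x∈ , y∈ , a) → lt , A⊆S x∈ , A⊆S y∈ , a)
        (λ (lt , x∈ , y∈ , a) → lt , B⊆S x∈ , B⊆S y∈ , a)
        (λ { (≡.refl , ≡.refl) → p<q , A⊆S p∈A , B⊆S q∈B , adj })
        (λ (_ , x∈A , _) (_ , x∈B , _) → disjoint x∈A x∈B)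
        (λ { (_ , _ , y∈A , _) (_ , ≡.refl) → disjoint y∈A q∈B })
        (λ { (_ , x∈B , _) (≡.refl , _) → disjoint p∈A x∈B })
        (f x y)
        where
        S⇒ : x Fin.< y × x ∈ S × y ∈ S × Adj x y →
             (x Fin.< y × x ∈ A × y ∈ A × Adj x y) ⊎
             (x Fin.< y × x ∈ B × y ∈ B × Adj x y) ⊎ (x ≡ p × y ≡ q)
        S⇒ (lt , x∈S , y∈S , a) with cover x∈S | cover y∈S
        ... | inj₁ x∈A | inj₁ y∈A = inj₁ (lt , x∈A , y∈A , a)
        ... | inj₂ x∈B | inj₂ y∈B = inj₂ (inj₁ (lt , x∈B , y∈B , a))
        ... | inj₁ x∈A | inj₂ y∈B = inj₂ (inj₂ (crossing x∈A y∈B a))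
        ... | inj₂ x∈B | inj₁ y∈A with crossing y∈A x∈B (adj-sym a)
        ...   | ≡.refl , ≡.refl = contradiction p<q (Fin.<-asym lt)

    -- For p > q the sum contains f q p in place of f p q.
    ∑E-cut : ∀ {f} → f p q ≈ f q p → EdgeCut graph S p q A B →
             ∑E[_] G S f ≈ ∑E[_] G A f + ∑E[_] G B f + f p q
    ∑E-cut {p} {q} f-sym cut with Fin.<-cmp p q
    ... | tri< p<q _ _ = ∑E-cut-< p<q cut
    ... | tri≈ _ p≡q _ = contradiction p≡q (adj⇒≢ graph (EdgeCut.adj cut))
    ... | tri> _ _ q<p = trans (∑E-cut-< q<p (EdgeCut-swap graph cut))
                               (+-cong (+-comm _ _) (sym f-sym))

    W-cut : EdgeCut graph S p q A B → W G S ≈ W G A + W G B + w p q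
    W-cut cut = ∑E-cut (w-sym (EdgeCut.adj cut)) cut

    -- Hierarchies from splits

    -- The sum of w h_H over the edges of G[S].
    hierarchyCost : Subset n → BinaryTree {n} → Carrier
    hierarchyCost S H = ∑E[_] G S (λ x y → w x y * fromℕ (height H x y))

    join-cost : ∀ {l r} (cut : EdgeCut graph S p q A B)
      (hA : HierarchyOn graph A l) (hB : HierarchyOn graph B r) →
      hierarchyCost S (Join.joined graph cut hA hB) ≤
        hierarchyCost A l + hierarchyCost B r + w p q * fromℕ (∣ S ∣ ℕ.∸ 1)
    join-cost cut hA hB = ≤-respˡ
      (sym (∑E-cut
        (*-cong (w-sym adj) (fromℕ-≡ (≡.trans (height-AB p∈A q∈B) (≡.sym (height-BA q∈B p∈A))))) cut))
      (+-mono-≤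
        (+-mono-≤
          (∑E-mono λ x∈A y∈A _ → ≤-reflexive (*-congˡ (fromℕ-≡ (height-A x∈A y∈A))))
          (∑E-mono λ x∈B y∈B _ → ≤-reflexive (*-congˡ (fromℕ-≡ (height-B x∈B y∈B)))))
        (≤-reflexive (*-congˡ (fromℕ-≡ (height-AB p∈A q∈B)))))
      where
      open EdgeCut cut
      open Join graph cut hA hB

    -- The data of e_S with denominators cleared: the sizes m(A) and m(B) are at
    -- most (1 - 1/Δ) m(S), and w(e_S) m(S) ≤ Λ W(S), where m(S) = |S| - 1.
    record Split (Δ : ℕ) (Λ : Carrier) (S : Subset n) : Set (c ⊔ˡ ℓ₁ ⊔ˡ ℓ₂) where
      field
        {p₀ q₀} : Fin n
        {A₀ B₀} : Subset n
        cut     : EdgeCut graph S p₀ q₀ A₀ B₀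
        light-A : fromℕ Δ * fromℕ (∣ A₀ ∣ ℕ.∸ 1) ≤ fromℕ (Δ ℕ.∸ 1) * fromℕ (∣ S ∣ ℕ.∸ 1)
        light-B : fromℕ Δ * fromℕ (∣ B₀ ∣ ℕ.∸ 1) ≤ fromℕ (Δ ℕ.∸ 1) * fromℕ (∣ S ∣ ℕ.∸ 1)
        cheap   : w p₀ q₀ * fromℕ (∣ S ∣ ℕ.∸ 1) ≤ Λ * W G S

    -- Splits need to exist only up to double negation, as every conclusion drawn
    -- from them is an inequality between reals.
    Splits : ℕ → Carrier → Set (c ⊔ˡ ℓ₁ ⊔ˡ ℓ₂)
    Splits Δ Λ = ∀ S → ConnectedOn graph S → 2 ℕ.≤ ∣ S ∣ → ¬ ¬ Split Δ Λ S

    module Recursion (Δ : ℕ) (2≤Δ : 2 ℕ.≤ Δ) (Λ : Carrier) (0≤Λ : 0# ≤ Λ)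
                     (splits : Splits Δ Λ) where

      1≤Δ-1 : 1 ℕ.≤ Δ ℕ.∸ 1
      1≤Δ-1 = ℕ.∸-monoˡ-≤ 1 2≤Δ

      b : Carrier
      b = fromℕ Δ / fromℕ (Δ ℕ.∸ 1) ⟨ fromℕ#0 1≤Δ-1 ⟩

      -- A split lowers the exponent of the size bound by one.  The bound s < b^j
      -- is weakened to the negation of b^j ≤ s, so that it passes to the parts
      -- by cancellation.
      light-part : ∀ j {a s} → fromℕ Δ * a ≤ fromℕ (Δ ℕ.∸ 1) * s →
                   ¬ (b ^ suc j ≤ s) → ¬ (b ^ j ≤ a)
      light-part j light s<b^1+j b^j≤a = s<b^1+j (*-cancelˡ-≤ (fromℕ>0 1≤Δ-1)
        (≤-respˡ (trans (*-congʳ (sym (/-cancel (fromℕ Δ) (fromℕ#0 1≤Δ-1)))) (*-assoc _ _ _))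
          (≤-trans (*-monoˡ-≤ (0≤fromℕ Δ) b^j≤a) light)))

      -- In use, v is the weight of the split edge, e its contribution to the
      -- cost, and a and b′ are the costs of the two parts.
      join-bound : ∀ {J a b′ wA wB v s} → 0# ≤ J → 0# ≤ v → s ≈ wA + wB + v →
                   ∀ {e} → a ≤ Λ * J * wA → b′ ≤ Λ * J * wB → e ≤ Λ * s →
                   a + b′ + e ≤ Λ * (1# + J) * s
      join-bound {J} {a} {b′} {wA} {wB} {v} {s} 0≤J 0≤v s≈ a≤ b≤ e≤ =
        ≤-trans (+-mono-≤ (≤-trans (+-mono-≤ a≤ b≤) (≤-+-nonneg (0≤* (0≤* 0≤Λ 0≤J) 0≤v))) e≤)
          (≤-reflexive (trans
            (+-congˡ (*-cong (sym (*-identityʳ Λ)) s≈))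
            (trans
              (solve 6 (λ Λ o J wA wB v →
                 (Λ :* J :* wA :+ Λ :* J :* wB :+ Λ :* J :* v) :+ Λ :* o :* (wA :+ wB :+ v) :=
                 Λ :* (o :+ J) :* (wA :+ wB :+ v)) refl Λ 1# J wA wB v)
              (*-congˡ (sym s≈)))))
        where open Solve

      -- A hierarchy on S with the cost allowed by j levels of splits.
      Hierarchy : ℕ → Subset n → Set ℓ₂
      Hierarchy j S = ∃[ H ] (HierarchyOn graph S H × hierarchyCost S H ≤ Λ * fromℕ j * W G S)

      singleton : ∀ j → ConnectedOn graph S → Nonempty S → ∣ S ∣ ℕ.≤ 1 → Hierarchy j S
      singleton {S} j conn (x , x∈S) ∣S∣≤1 = leaf x , leaf-hierarchy graph conn x∈S ∣S∣≡1 ,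
        ≤-respˡ (sym (∑E-zero edgeless)) (0≤* (0≤* 0≤Λ (0≤fromℕ j)) (0≤W S))
        where
        ∣S∣≡1 : ∣ S ∣ ≡ 1
        ∣S∣≡1 = ℕ.≤-antisym ∣S∣≤1 (x∈p⇒1≤∣p∣ x∈S)
        edgeless : ∀ {x y} → x ∈ S → y ∈ S → ¬ Adj x y
        edgeless x∈S y∈S a =
          contradiction (ℕ.≤-trans (distinct⇒2≤∣p∣ x∈S y∈S (adj⇒≢ graph a)) ∣S∣≤1) λ { (s≤s ()) }

      hierarchy : ∀ j → ConnectedOn graph S → Nonempty S →
                  ¬ (b ^ j ≤ fromℕ (∣ S ∣ ℕ.∸ 1)) → ¬ ¬ Hierarchy j S
      hierarchy {S} j conn ne small with ∣ S ∣ ℕ.≤? 1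
      hierarchy {S} j conn ne small | yes ∣S∣≤1 = λ ¬h → ¬h (singleton j conn ne ∣S∣≤1)
      hierarchy {S} zero conn ne small | no ∣S∣≰1 = contradiction
        (≤-respˡ fromℕ-1 (fromℕ-mono (ℕ.∸-monoˡ-≤ 1 (ℕ.≰⇒> ∣S∣≰1)))) small
      hierarchy {S} (suc j) conn ne small | no ∣S∣≰1 =
        ¬¬-bind (splits S conn (ℕ.≰⇒> ∣S∣≰1)) λ split →
        let open Split split
            open EdgeCut cut
        in ¬¬-bind (hierarchy j A-conn (_ , p∈A) (light-part j light-A small)) λ (l , hA , costA) →
           ¬¬-map (λ (r , hB , costB) →
             node l tt r , Join.join graph cut hA hB conn ,
             ≤-trans (join-cost cut hA hB)
                     (join-bound (0≤fromℕ j) (<⇒≤ (w-pos adj)) (W-cut cut) costA costB cheap))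
           (hierarchy j B-conn (_ , q∈B) (light-part j light-B small))

    -- Comparison of the two optima in a tree

    module _ (2≤n : 2 ℕ.≤ n) (tree : IsTree graph) where

      private
        connected = proj₁ tree
        acyclic   = proj₂ tree

      2≤∣⊤∣ : 2 ℕ.≤ ∣ ⊤ {n} ∣
      2≤∣⊤∣ = ≡.subst (2 ℕ.≤_) (≡.sym (∣⊤∣≡n n)) 2≤n

      0<W⊤ : 0# < W G ⊤
      0<W⊤ = 0<W (proj₂ (proj₂ (some-edge graph connected 2≤∣⊤∣)))

      W⊤≤cost : ∀ {u} → FreeFeasible G u → W G ⊤ ≤ cost G u
      W⊤≤cost (_ , u≥d) = ∑E-mono λ {x} {y} _ _ a → ≤-respˡ (*-identityʳ (w x y))
        (*-monoˡ-≤ (<⇒≤ (w-pos a)) (≤-respˡ fromℕ-1 (u≥d x y 1 (adj⇒distance1 graph a))))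

      -- Split ⊤: 0 ≤ w(e) m(⊤) ≤ Λ W(⊤) and W(⊤) > 0.
      0≤Λ : ∀ {Δ Λ} → Splits Δ Λ → 0# ≤ Λ
      0≤Λ {Λ = Λ} splits = negated-stable (¬¬-map nonneg (splits ⊤ connected 2≤∣⊤∣))
        where
        nonneg : Split _ Λ ⊤ → 0# ≤ Λ
        nonneg split = *-cancelˡ-≤ 0<W⊤ (≤-respˡ (sym (zeroʳ _)) (≤-respʳ (*-comm Λ _)
          (≤-trans (0≤* (<⇒≤ (w-pos (EdgeCut.adj cut))) (0≤fromℕ (∣ ⊤ {n} ∣ ℕ.∸ 1))) cheap)))
          where open Split split

      -- Positivity of free is genuine: it comes from an edge of G by
      -- cotransitivity of <.
      ratioBound : ∀ {Δ Λ} (2≤Δ : 2 ℕ.≤ Δ) → Splits Δ Λ → RatioBound G Δ 2≤Δ Λ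
      ratioBound {Δ} {Λ} 2≤Δ splits card free k
        (_ , card-min) ((u , feasible , cost≈free) , _) (_ , n-1<b^1+k) =
        0<free , *-cancelˡ-≤ 0<free (≤-respˡ (sym (/-cancel card _))
          (≤-trans card≤ (≤-respʳ (*-comm _ _) (*-monoˡ-≤ (0≤* 0≤Λ′ (0≤fromℕ (suc k))) W⊤≤free))))
        where
        0≤Λ′ = 0≤Λ splits
        open Recursion Δ 2≤Δ Λ 0≤Λ′ splits
        W⊤≤free : W G ⊤ ≤ free
        W⊤≤free = ≤-respʳ cost≈free (W⊤≤cost feasible)
        0<free : 0# < free
        0<free = <-≤-trans 0<W⊤ W⊤≤free
        card≤ : card ≤ Λ * fromℕ (suc k) * W G ⊤
        card≤ = negated-stable (¬¬-map
          (λ (H , h , cost≤) → ≤-trans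
            (card-min H (HierarchyOn-⊤ graph h , λ x y _ → HierarchyOn.dominates h ∈⊤ ∈⊤)) cost≤)
          (hierarchy (suc k) connected (1≤∣p∣⇒Nonempty (ℕ.≤-trans (s≤s z≤n) 2≤∣⊤∣))
            (λ b^1+k≤n-1 → b^1+k≤n-1
              (≡.subst (λ m → fromℕ (m ℕ.∸ 1) < b ^ suc k) (≡.sym (∣⊤∣≡n n)) n-1<b^1+k))))

      balancedSplits⇒Splits : ∀ {Δ Λ} (2≤Δ : 2 ℕ.≤ Δ) → HasBalancedSplits G Δ 2≤Δ Λ → Splits Δ Λ
      balancedSplits⇒Splits {suc δ} {Λ} 2≤Δ@(s≤s _) balanced S conn 2≤∣S∣ ¬split =
        let (p , q , A , B , r , compA , compB , light , cheap) = balanced S conn 2≤∣S∣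
        in ¬split (record
          { cut     = components⇒EdgeCut graph acyclic conn r compA compB
          ; light-A = light-side (ℕ.m≤m⊔n (∣ A ∣ ℕ.∸ 1) (∣ B ∣ ℕ.∸ 1)) light
          ; light-B = light-side (ℕ.m≤n⊔m (∣ A ∣ ℕ.∸ 1) (∣ B ∣ ℕ.∸ 1)) light
          ; cheap   = ≤-respˡ (*-comm _ _) (≤-respʳ (*-/-cancel Λ (W G S) _)
                        (*-monoˡ-≤ (0≤fromℕ (∣ S ∣ ℕ.∸ 1)) cheap))
          })
        where
        Δ#0 = fromℕ#0 (ℕ.<⇒≤ 2≤Δ)
        light-side : ∀ {a m s} → a ℕ.≤ m → fromℕ m ≤ (1# - 1# / fromℕ (suc δ) ⟨ Δ#0 ⟩) * s →
                     fromℕ (suc δ) * fromℕ a ≤ fromℕ δ * s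
        light-side {s = s} a≤m light =
          ≤-respʳ (trans (sym (*-assoc _ _ _)) (*-congʳ Δ[1-1/Δ]≈δ))
          (*-monoˡ-≤ (0≤fromℕ (suc δ)) (≤-trans (fromℕ-mono a≤m) light))
          where
          open import Relation.Binary.Reasoning.Setoid setoid
          Δ[1-1/Δ]≈δ : fromℕ (suc δ) * (1# - 1# / fromℕ (suc δ) ⟨ Δ#0 ⟩) ≈ fromℕ δ
          Δ[1-1/Δ]≈δ = begin
            D * (1# - i)
              ≈⟨ add-sub-cancel _ (D * i) ⟨
            D * (1# - i) + D * i - D * i
              ≈⟨ +-cong (trans (sym (distribˡ D _ i)) (*-congˡ (sub-add-cancel 1# i)))
                        (-‿cong (/-cancel 1# Δ#0)) ⟩
            D * 1# - 1#
              ≈⟨ +-congʳ (trans (*-identityʳ D) (+-comm 1# (fromℕ δ))) ⟩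
            fromℕ δ + 1# - 1#
              ≈⟨ add-sub-cancel _ 1# ⟩
            fromℕ δ ∎
            where
            D = fromℕ (suc δ)
            i = 1# / D ⟨ Δ#0 ⟩

      -- A connected S spans at least |S| - 1 edges: cut along any edge and
      -- proceed by induction, with k a bound on |S|.
      minWeight*m≤W : ∀ {m} → (∀ {x y} → Adj x y → m ≤ w x y) → ∀ k {S} → ∣ S ∣ ℕ.≤ k →
                    ConnectedOn graph S → m * fromℕ (∣ S ∣ ℕ.∸ 1) ≤ W G S
      minWeight*m≤W {m} m≤w k {S} ∣S∣≤k conn with ∣ S ∣ ℕ.≤? 1
      ... | yes ∣S∣≤1 = ≤-respˡ
        (sym (trans (*-congˡ (fromℕ-≡ (ℕ.m≤n⇒m∸n≡0 ∣S∣≤1))) (zeroʳ m))) (0≤W S)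
      minWeight*m≤W m≤w zero ∣S∣≤0 conn | no ∣S∣≰1 = contradiction (ℕ.≤-trans ∣S∣≤0 z≤n) ∣S∣≰1
      minWeight*m≤W {m} m≤w (suc k) {S} ∣S∣≤1+k conn | no ∣S∣≰1 = negated-stable (¬¬-map
        (λ (p , q , A , B , cut) →
          let open EdgeCut cut
              a = ∣ A ∣ ℕ.∸ 1
              b = ∣ B ∣ ℕ.∸ 1
              ∣A∣≡ = 1≤⇒suc-∸ (x∈p⇒1≤∣p∣ p∈A)
              ∣B∣≡ = 1≤⇒suc-∸ (x∈p⇒1≤∣p∣ q∈B)
              ∣S∣-1≡ : ∣ S ∣ ℕ.∸ 1 ≡ a ℕ.+ suc b
              ∣S∣-1≡ = ≡.cong (ℕ._∸ 1) (≡.trans ∣S∣≡∣A∣+∣B∣ (≡.cong₂ ℕ._+_ ∣A∣≡ ∣B∣≡))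
              1+a+b≤k : suc (a ℕ.+ b) ℕ.≤ k
              1+a+b≤k = ≡.subst (ℕ._≤ k) (≡.trans ∣S∣-1≡ (ℕ.+-suc a b)) (ℕ.∸-monoˡ-≤ 1 ∣S∣≤1+k)
              ∣A∣≤k = ≡.subst (ℕ._≤ k) (≡.sym ∣A∣≡) (ℕ.≤-trans (s≤s (ℕ.m≤m+n a b)) 1+a+b≤k)
              ∣B∣≤k = ≡.subst (ℕ._≤ k) (≡.sym ∣B∣≡) (ℕ.≤-trans (s≤s (ℕ.m≤n+m b a)) 1+a+b≤k)
          in ≤-respˡ
               (sym (trans (*-congˡ (trans (fromℕ-≡ ∣S∣-1≡) (fromℕ-homo-+ a (suc b))))
                           (expand m (fromℕ a) (fromℕ b))))
               (≤-respʳ (sym (W-cut cut))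
                 (+-mono-≤ (+-mono-≤ (minWeight*m≤W m≤w k ∣A∣≤k A-conn)
                                     (minWeight*m≤W m≤w k ∣B∣≤k B-conn))
                           (m≤w adj))))
        (¬¬-edge-cut graph acyclic conn (ℕ.≰⇒> ∣S∣≰1)))
        where
        1≤⇒suc-∸ : ∀ {l} → 1 ℕ.≤ l → l ≡ suc (l ℕ.∸ 1)
        1≤⇒suc-∸ (s≤s _) = ≡.refl
        expand : ∀ m a b → m * (a + (1# + b)) ≈ m * a + m * b + m
        expand m a b = trans
          (solve 4 (λ m a b o → m :* (a :+ (o :+ b)) := m :* a :+ m :* b :+ m :* o) refl m a b 1#)
          (+-congˡ (*-identityʳ m))
          where open Solve

      -- For e_S any balanced edge will do.
      ratio⇒Splits : ∀ {Δ Λ} → 2 ℕ.≤ Δ → MaxDegree≤ graph Δ → WeightRatio≤ G Λ → Splits Δ Λ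
      ratio⇒Splits {suc δ} {Λ} (s≤s 1≤δ) maxDegree
        (M , m , isMin@((_ , adj₀ , w≈m) , m≤w) , (_ , w≤M) , M/m≤Λ) S conn 2≤∣S∣ = ¬¬-map
        (λ (p , q , A , B , cut , light-A , light-B) → record
          { cut     = cut
          ; light-A = light-side light-A
          ; light-B = light-side light-B
          ; cheap   = ≤-trans (*-monoʳ-≤ (0≤fromℕ (∣ S ∣ ℕ.∸ 1))
                        (≤-trans (w≤M _ (EdgeCut.adj cut)) M≤mΛ))
                      (≤-respˡ (trans (sym (*-assoc Λ m _)) (*-congʳ (*-comm Λ m)))
                        (*-monoˡ-≤ 0≤Λ″ (minWeight*m≤W (λ a → m≤w _ a) ∣ S ∣ ℕ.≤-refl conn)))
          })
        (¬¬-balanced-cut graph acyclic 1≤δ maxDegree conn 2≤∣S∣)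
        where
        0<m : 0# < m
        0<m = <-respʳ-≈ w≈m (w-pos adj₀)
        M≤mΛ : M ≤ m * Λ
        M≤mΛ = ≤-respˡ (/-cancel M (minWeight#0 G isMin)) (*-monoˡ-≤ (<⇒≤ 0<m) M/m≤Λ)
        0≤Λ″ : 0# ≤ Λ
        0≤Λ″ = *-cancelˡ-≤ 0<m (≤-respˡ (sym (zeroʳ m))
          (≤-trans (<⇒≤ (<-≤-trans (w-pos adj₀) (w≤M _ adj₀))) M≤mΛ))
        light-side : ∀ {a s} → suc δ ℕ.* a ℕ.≤ δ ℕ.* s → fromℕ (suc δ) * fromℕ a ≤ fromℕ δ * fromℕ s
        light-side {a} {s} light = ≤-respˡ (fromℕ-homo-* (suc δ) a)
          (≤-respʳ (fromℕ-homo-* δ s) (fromℕ-mono light))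

open import Data.Nat.Base using (_≤_)
open Weighted using (WeightedGraph; HasBalancedSplits; WeightRatio≤; RatioBound)
open Weighted.WeightedGraph using (graph)

corollary12 : ∀ {c ℓ₁ ℓ₂} (ℝ : Reals c ℓ₁ ℓ₂) (Δ : ℕ) (2≤Δ : 2 ≤ Δ) (Λ : Reals.Carrier ℝ) →
    ∀ {n : ℕ} → 2 ≤ n → (G : WeightedGraph ℝ n) →
    IsTree (graph G) → MaxDegree≤ (graph G) Δ →
    (HasBalancedSplits ℝ G Δ 2≤Δ Λ → RatioBound ℝ G Δ 2≤Δ Λ) ×
    (WeightRatio≤ ℝ G Λ → RatioBound ℝ G Δ 2≤Δ Λ)
corollary12 ℝ Δ 2≤Δ Λ 2≤n G tree maxDegree =
  (λ balanced → ratioBound ℝ G 2≤n tree 2≤Δ (balancedSplits⇒Splits ℝ G 2≤n tree 2≤Δ balanced)) ,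
  (λ ratio → ratioBound ℝ G 2≤n tree 2≤Δ (ratio⇒Splits ℝ G 2≤n tree 2≤Δ maxDegree ratio))
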